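{- Every $P_4$-reducible graph is GaTEx.
   Context: All graphs are finite, simple and undirected. A graph is $P_4$-reducible if every vertex belongs to at most one induced path on four vertices. A galled-tree on a finite nonempty set $X$ is a directed acyclic graph $N=(V,E)$ such that either $V=X=\{x\}$ and $E=\emptyset$, or: (N1) there is a unique root with indegree 0 and outdegree at least 2; (N2) $x\in X$ iff $x$ has outdegree 0 and indegree 1; (N3) every non-root $v\in V\setminus X$ has either indegree 1 and outdegree at least 2, or indegree 2 and outdegree at least 1 (hybrid-vertex); (N4) each biconnected component $C$ of $N$ contains at most one hybrid-vertex whose two in-neighbours both belong to $C$. For $x,y\in X$, $\mathrm{lca}_N(x,y)$ is the (unique) minimal common ancestor of $x,y$. A labeled galled-tree $(N,t)$ has $t:V\to\{0,1,\odot\}$ with $t(x)=\odot$ iff $x\in X$; it explains the graph on $X$ where $\{x,y\}$ is an edge iff $t(\mathrm{lca}_N(x,y))=1$. A graph is GaTEx if it is isomorphic to a graph explained by some labeled galled-tree. -}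

module Defs where

open import Data.Nat using (ℕ; zero; suc; _≤_)
open import Data.Fin using (Fin)
open import Data.Bool using (Bool; true; false; if_then_else_)
open import Data.List using (List; map; allFin)
open import Data.Nat.ListAction using (sum)
open import Data.Product using (Σ; ∃; _×_; _,_)
open import Data.Sum using (_⊎_)
open import Relation.Nullary using (¬_)
open import Relation.Binary.PropositionalEquality using (_≡_; _≢_)
open import Function.Definitions using (Injective)

infix 2 _⇔_
_⇔_ : Set → Set → Set
A ⇔ B = (A → B) × (B → A)

record Graph (n : ℕ) : Set where
  field
    adj    : Fin n → Fin n → Bool
    sym    : ∀ x y → adj x y ≡ adj y x
    irrefl : ∀ x → adj x x ≡ false
open Graph public

IsInducedP4 : ∀ {n} → Graph n → Fin n → Fin n → Fin n → Fin n → Set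
IsInducedP4 G a b c d =
  (a ≢ b × a ≢ c × a ≢ d × b ≢ c × b ≢ d × c ≢ d) ×
  (adj G a b ≡ true × adj G b c ≡ true × adj G c d ≡ true) ×
  (adj G a c ≡ false × adj G b d ≡ false × adj G a d ≡ false)

_∈₄_ : ∀ {n} → Fin n → (Fin n × Fin n × Fin n × Fin n) → Set
x ∈₄ (a , b , c , d) = x ≡ a ⊎ x ≡ b ⊎ x ≡ c ⊎ x ≡ d

-- every vertex belongs to at most one induced P4 (an induced P4 is
-- identified with its vertex set)
P4Reducible : ∀ {n} → Graph n → Set
P4Reducible {n} G =
  ∀ (v a b c d a' b' c' d' : Fin n) →
  IsInducedP4 G a b c d → IsInducedP4 G a' b' c' d' →
  v ∈₄ (a , b , c , d) → v ∈₄ (a' , b' , c' , d') →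
  ∀ x → (x ∈₄ (a , b , c , d)) ⇔ (x ∈₄ (a' , b' , c' , d'))

record Digraph (m : ℕ) : Set where
  field
    arc : Fin m → Fin m → Bool
open Digraph public

module _ {m : ℕ} (N : Digraph m) where

  data Reach : Fin m → Fin m → Set where
    here : ∀ {u} → Reach u u
    step : ∀ {u w v} → arc N u w ≡ true → Reach w v → Reach u v

  Acyclic : Set
  Acyclic = ∀ u v → arc N u v ≡ true → ¬ Reach v u

  indeg : Fin m → ℕ
  indeg v = sum (map (λ u → if arc N u v then 1 else 0) (allFin m))

  outdeg : Fin m → ℕ
  outdeg u = sum (map (λ v → if arc N u v then 1 else 0) (allFin m))

  Subset : Set
  Subset = Fin m → Bool

  _∈S_ : Fin m → Subset → Set
  v ∈S S = S v ≡ true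

  _⊆S_ : Subset → Subset → Set
  S ⊆S T = ∀ v → v ∈S S → v ∈S T

  UAdj : Fin m → Fin m → Set
  UAdj u v = arc N u v ≡ true ⊎ arc N v u ≡ true

  data UPath (P : Fin m → Set) : Fin m → Fin m → Set where
    stay : ∀ {u} → P u → UPath P u u
    move : ∀ {u w v} → P u → UAdj u w → UPath P w v → UPath P u v

  ConnectedOn : (Fin m → Set) → Set
  ConnectedOn P = ∀ u v → P u → P v → UPath P u v

  Biconnected : Subset → Set
  Biconnected S =
    ConnectedOn (λ v → v ∈S S) ×
    (∀ w → w ∈S S → ConnectedOn (λ v → v ∈S S × v ≢ w))

  IsBiconnectedComponent : Subset → Set
  IsBiconnectedComponent C =
    Biconnected C × (∀ T → C ⊆S T → Biconnected T → T ⊆S C)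

-- Galled-trees.  The leaf set X is given as the image of an injective map
-- ℓ : Fin n → Fin m (this also fixes an identification of X with Fin n).

InX : ∀ {n m} → (Fin n → Fin m) → Fin m → Set
InX ℓ v = ∃ λ x → ℓ x ≡ v

IsRoot : ∀ {m} → Digraph m → Fin m → Set
IsRoot N r = indeg N r ≡ 0

TrivialGalledTree : ∀ {n m} → Digraph m → (Fin n → Fin m) → Set
TrivialGalledTree {n} {m} N ℓ =
  m ≡ 1 × Injective _≡_ _≡_ ℓ × (∀ v → InX ℓ v) × (∀ u v → arc N u v ≡ false)

ProperGalledTree : ∀ {n m} → Digraph m → (Fin n → Fin m) → Set
ProperGalledTree {n} {m} N ℓ =
  Acyclic N ×
  Injective _≡_ _≡_ ℓ ×
  (Σ (Fin m) λ r → IsRoot N r × 2 ≤ outdeg N r × (∀ v → IsRoot N v → v ≡ r)) ×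
  (∀ v → InX ℓ v ⇔ (outdeg N v ≡ 0 × indeg N v ≡ 1)) ×
  (∀ v → ¬ IsRoot N v → ¬ InX ℓ v →
     (indeg N v ≡ 1 × 2 ≤ outdeg N v) ⊎ (indeg N v ≡ 2 × 1 ≤ outdeg N v)) ×
  (∀ (C : Fin m → Bool) → IsBiconnectedComponent N C →
     ∀ h h' →
     C h ≡ true → indeg N h ≡ 2 → (∀ u → arc N u h ≡ true → C u ≡ true) →
     C h' ≡ true → indeg N h' ≡ 2 → (∀ u → arc N u h' ≡ true → C u ≡ true) →
     h ≡ h')

IsGalledTree : ∀ {n m} → Digraph m → (Fin n → Fin m) → Set
IsGalledTree N ℓ = TrivialGalledTree N ℓ ⊎ ProperGalledTree N ℓ

data Label : Set where
  lab0 lab1 odot : Label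

IsLca : ∀ {m} → Digraph m → Fin m → Fin m → Fin m → Set
IsLca N u v a =
  Reach N a u × Reach N a v ×
  (∀ b → Reach N b u → Reach N b v → Reach N a b → b ≡ a)

ValidLabeling : ∀ {n m} → (Fin n → Fin m) → (Fin m → Label) → Set
ValidLabeling ℓ t = ∀ v → (t v ≡ odot) ⇔ InX ℓ v

Explains : ∀ {n m} → Graph n → Digraph m → (Fin n → Fin m) → (Fin m → Label) → Set
Explains G N ℓ t =
  ∀ x y → (adj G x y ≡ true) ⇔ (∃ λ a → IsLca N (ℓ x) (ℓ y) a × t a ≡ lab1)

GaTEx : ∀ {n} → Graph n → Set
GaTEx {n} G =
  Σ ℕ λ m → Σ (Digraph m) λ N → Σ (Fin n → Fin m) λ ℓ → Σ (Fin m → Label) λ t →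
    IsGalledTree N ℓ × ValidLabeling ℓ t × Explains G N ℓ t

module Submission where

open import Defs
open import Data.Nat as ℕ using (ℕ; zero; suc; _≤_; _<_; _+_; s≤s)
import Data.Nat.Properties as ℕ
open import Data.Nat.ListAction using (sum)
open import Data.Bool as Bool using (Bool; true; false; not; _∧_; if_then_else_)
open import Data.Bool.Properties using (not-involutive)
open import Data.Fin using (Fin; zero; suc; toℕ; inject₁)
open import Data.Fin.Patterns using (0F; 1F; 2F; 3F; 4F; 5F)
open import Data.Fin.Properties using (_≟_; all?; any?; toℕ<n; +↔⊎)
open import Data.List as List using (List; []; _∷_; [_]; _++_; length; allFin; filter)
open import Data.List.Properties using (++-identityʳ; length-++; length-map; length-tabulate)
open import Data.List.Relation.Unary.Any using (here; there)
open import Data.List.Relation.Unary.All as All using (All; []; _∷_)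
open import Data.List.Relation.Unary.All.Properties using (++⁻ˡ)
open import Data.List.Relation.Unary.AllPairs using ([]; _∷_)
open import Data.List.Relation.Unary.Unique.Propositional using (Unique)
import Data.List.Relation.Unary.Unique.Propositional.Properties as Unique
open import Data.List.Membership.Propositional using (_∈_)
open import Data.List.Membership.Propositional.Properties
  using (∈-∃++; ∈-++⁺ˡ; ∈-++⁺ʳ; ∈-++⁻; ∈-filter⁺; ∈-filter⁻; ∈-map⁺; ∈-map⁻; ∈-allFin)
open import Data.List.Membership.Propositional.Properties.WithK using (unique∧set⇒bag)
import Data.List.Membership.DecPropositional as DecMembership
open import Data.List.Relation.Binary.BagAndSetEquality using (∼bag⇒↭)
open import Data.List.Relation.Binary.Permutation.Propositional
  using (_↭_; ↭-refl; ↭-sym; ↭-trans; ↭-prep; ↭⇒↭ₛ)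
open import Data.List.Relation.Binary.Permutation.Propositional.Properties
  using (shift; ++-comm; ∈-resp-↭; ↭-length)
import Data.List.Relation.Binary.Permutation.Setoid.Properties as SetoidPerm
open import Data.Vec as Vec using (Vec; []; _∷_)
open import Data.Product using (Σ; ∃; ∃₂; _×_; _,_; proj₁; proj₂)
open import Data.Product.Properties using (≡-dec)
open import Data.Sum as Sum using (_⊎_; inj₁; inj₂)
open import Data.Sum.Function.Propositional using (_⊎-↔_)
open import Data.Unit using (tt)
open import Data.Empty using (⊥; ⊥-elim)
open import Function using (_∘_; _↔_; Inverse; mk↔ₛ′; mk⇔)
open import Function.Properties.Inverse using (↔⇒↣)
open import Function.Construct.Composition using (_↔-∘_)
open import Function.Construct.Identity using (↔-id)
open import Function.Construct.Symmetry using (↔-sym)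
open import Relation.Nullary using (¬_; Dec; yes; no; ¬?; does)
open import Relation.Nullary.Decidable
  using (map′; _×-dec_; _⊎-dec_; _→-dec_; toWitness; via-injection; ⌊_⌋; dec-true; dec-false)
open import Relation.Binary using (DecidableEquality)
open import Relation.Binary.Construct.Closure.ReflexiveTransitive using (Star; ε; _◅_; _◅◅_; gmap)
open import Relation.Binary.PropositionalEquality as ≡
  using (_≡_; _≢_; refl; trans; cong; subst; subst₂; setoid; ≢-sym)

-- Inserting vertices one at a time shows that a P₄-reducible graph is a single
-- vertex, disconnected, co-disconnected, or consists of an induced path a-b-c-d
-- and further vertices adjacent to b and c but not to a and d.  Indeed, once
-- there is a path a-b-c-d, every other vertex sees none of it, all of it, or
-- just b and c (otherwise it lies on a second P₄ meeting the first), and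
-- vertices of the last kind are anticomplete to the first and complete to the
-- second.  Recursively, a (co-)disconnected graph is explained by joining two
-- galled-trees under a new root, and the path case by a single gall whose
-- hybrid vertex carries b.  Galls in different places of the resulting
-- network are separated by the root of a subtree, which is a cut vertex, so
-- they never share a biconnected component.

-- Lists up to permutation

-- The path on four vertices is the smallest graph that no labelled tree explains, and a hybrid
-- vertex repairs exactly this: having two parents, `b` can meet `a` on one side of the gall and
-- `c`, `d` on the other, while `a` meets `c` and `d` only at the root. The class of `P₄`-reducible
-- graphs and the list of possible outcomes are both closed under complement, so insertion into a
-- co-disconnected graph reduces to insertion into a disconnected one. The networks are assembled
-- from a cherry and two galls. These are kept as frames with open slots, so that their degrees,
-- reachability and meets are finite facts settled by evaluation; the work left to reasoning is that
-- such facts survive when frames are hung below one another.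

Unique-resp-↭ : ∀ {A : Set} {xs ys : List A} → xs ↭ ys → Unique xs → Unique ys
Unique-resp-↭ {A} p = SetoidPerm.Unique-resp-↭ (setoid A) (↭⇒↭ₛ p)

extract : ∀ {A : Set} {x : A} {xs} → x ∈ xs → ∃ λ ys → xs ↭ x ∷ ys
extract x∈xs with ys , zs , refl ← ∈-∃++ x∈xs = ys ++ zs , shift _ ys zs

extract-≢ : ∀ {A : Set} {x y : A} {xs ys} → xs ↭ x ∷ ys → y ∈ xs → x ≢ y → y ∈ ys
extract-≢ p y∈xs x≢y with ∈-resp-↭ p y∈xs
... | here y≡x = ⊥-elim (x≢y (≡.sym y≡x))
... | there y∈ys = y∈ys

extract₄ : ∀ {A : Set} {a b c d : A} {xs} → a ∈ xs → b ∈ xs → c ∈ xs → d ∈ xs →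
  a ≢ b × a ≢ c × a ≢ d × b ≢ c × b ≢ d × c ≢ d → ∃ λ ys → xs ↭ a ∷ b ∷ c ∷ d ∷ ys
extract₄ {a = a} {b} {c} {d} a∈ b∈ c∈ d∈ (ab , ac , ad , bc , bd , cd)
  with _ , p ← extract a∈
  with _ , q ← extract (extract-≢ p b∈ ab)
  with _ , r ← extract (extract-≢ q (extract-≢ p c∈ ac) bc)
  with _ , s ← extract (extract-≢ r (extract-≢ q (extract-≢ p d∈ ad) bd) cd)
  = _ , ↭-trans p (↭-prep a (↭-trans q (↭-prep b (↭-trans r (↭-prep c s)))))

partitionᵇ-↭ : ∀ {A : Set} (f : A → Bool) xs →
  ∃₂ λ ys zs → xs ↭ ys ++ zs × All (λ x → f x ≡ true) ys × All (λ x → f x ≡ false) zs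
partitionᵇ-↭ f [] = [] , [] , ↭-refl , [] , []
partitionᵇ-↭ f (x ∷ xs) with partitionᵇ-↭ f xs | f x in fx
... | ys , zs , p , t , u | true = x ∷ ys , zs , ↭-prep x p , fx ∷ t , u
... | ys , zs , p , t , u | false =
  ys , x ∷ zs , ↭-trans (↭-prep x p) (↭-sym (shift x ys zs)) , t , fx ∷ u

Unique-++-≢ : ∀ {A : Set} {x y : A} xs {ys} → Unique (xs ++ ys) → x ∈ xs → y ∈ ys → x ≢ y
Unique-++-≢ (_ ∷ xs) (p ∷ _) (here refl) y∈ = All.lookup p (∈-++⁺ʳ xs y∈)
Unique-++-≢ (_ ∷ xs) (_ ∷ u) (there x∈) y∈ = Unique-++-≢ xs u x∈ y∈

Unique-++⁻ : ∀ {A : Set} (xs : List A) {ys} → Unique (xs ++ ys) → Unique xs × Unique ys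
Unique-++⁻ [] u = [] , u
Unique-++⁻ (x ∷ xs) (p ∷ u) with v , w ← Unique-++⁻ xs u = ++⁻ˡ xs p ∷ v , w

-- Induced paths and their neighbourhoods

true≢false : ∀ {b} → b ≡ true → b ≡ false → ⊥
true≢false refl ()

module _ {n : ℕ} (G : Graph n) where

  adj-sym : ∀ {x y e} → adj G x y ≡ e → adj G y x ≡ e
  adj-sym {x} {y} p = trans (sym G y x) p

  adj-≢ : ∀ {x y z} → adj G x z ≡ true → adj G y z ≡ false → x ≢ y
  adj-≢ p q refl = true≢false p q

  adjacent-≢ : ∀ {x y} → adj G x y ≡ true → x ≢ y
  adjacent-≢ {x} p refl = true≢false p (irrefl G x)

  inducedP4 : ∀ {a b c d} →
    adj G a b ≡ true → adj G b c ≡ true → adj G c d ≡ true →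
    adj G a c ≡ false → adj G b d ≡ false → adj G a d ≡ false → IsInducedP4 G a b c d
  inducedP4 ab bc cd ac bd ad =
    ( adjacent-≢ ab , ≢-sym (adj-≢ cd ad) , adj-≢ ab (adj-sym bd)
    , adjacent-≢ bc , adj-≢ (adj-sym ab) (adj-sym ad) , adjacent-≢ cd ) ,
    (ab , bc , cd) , (ac , bd , ad)

  -- Adjacency e to the two ends and e′ to the two midpoints of a path a-b-c-d.
  Sees : Bool → Bool → Fin n → Fin n → Fin n → Fin n → Fin n → Set
  Sees e e′ v a b c d =
    adj G v a ≡ e × adj G v b ≡ e′ × adj G v c ≡ e′ × adj G v d ≡ e

  -- `e = false` is the disconnected and `e = true` the co-disconnected case. Each cross pair
  -- carries `x ≢ y` because the complement negates adjacency at distinct vertices only.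
  data Decomposition (xs : List (Fin n)) : Set where
    single : ∀ x → xs ≡ [ x ] → Decomposition xs
    split  : ∀ e a as b bs → xs ↭ (a ∷ as) ++ (b ∷ bs) →
             (∀ {x y} → x ∈ a ∷ as → y ∈ b ∷ bs → x ≢ y × adj G x y ≡ e) → Decomposition xs
    path   : ∀ a b c d rs → xs ↭ a ∷ b ∷ c ∷ d ∷ rs → IsInducedP4 G a b c d →
             (∀ {r} → r ∈ rs → Sees false true r a b c d) → Decomposition xs

  edges? : ∀ xs ys →
    (∃₂ λ x y → x ∈ xs × y ∈ ys × adj G x y ≡ true) ⊎ (∀ {x y} → x ∈ xs → y ∈ ys → adj G x y ≡ false)
  edges? [] ys = inj₂ λ ()
  edges? (x ∷ xs) ys with partitionᵇ-↭ (adj G x) ys | edges? xs ys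
  ... | y ∷ _ , _ , p , t ∷ _ , _ | _ = inj₁ (x , y , here refl , ∈-resp-↭ (↭-sym p) (here refl) , t)
  ... | [] , _ | inj₁ (x′ , y , x′∈ , rest) = inj₁ (x′ , y , there x′∈ , rest)
  ... | [] , _ , p , _ , u | inj₂ none = inj₂ λ
    { (here refl) y∈ → All.lookup u (∈-resp-↭ p y∈)
    ; (there x∈) y∈ → none x∈ y∈ }

  split-unique : ∀ {xs} e a as b bs → Unique xs → xs ↭ (a ∷ as) ++ (b ∷ bs) →
    (∀ {x y} → x ∈ a ∷ as → y ∈ b ∷ bs → adj G x y ≡ e) → Decomposition xs
  split-unique e a as b bs u p cross = split e a as b bs p λ x∈ y∈ →
    Unique-++-≢ (a ∷ as) (Unique-resp-↭ p u) x∈ y∈ , cross x∈ y∈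

  module _ (red : P4Reducible G) {a b c d : Fin n} (P : IsInducedP4 G a b c d) where

    private
      ab = proj₁ (proj₁ (proj₂ P))
      bc = proj₁ (proj₂ (proj₁ (proj₂ P)))
      cd = proj₂ (proj₂ (proj₁ (proj₂ P)))
      ac = proj₁ (proj₂ (proj₂ P))
      bd = proj₁ (proj₂ (proj₂ (proj₂ P)))
      ad = proj₂ (proj₂ (proj₂ (proj₂ P)))

    only-P4 : ∀ {x y a′ b′ c′ d′} → ¬ x ∈₄ (a , b , c , d) → IsInducedP4 G a′ b′ c′ d′ →
      y ∈₄ (a , b , c , d) → y ∈₄ (a′ , b′ , c′ , d′) → x ∈₄ (a′ , b′ , c′ , d′) → ⊥
    only-P4 x∉ P′ y∈ y∈′ x∈′ = x∉ (proj₂ (red _ _ _ _ _ _ _ _ _ P P′ y∈ y∈′ _) x∈′)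

    -- Thirteen of the sixteen adjacency patterns are impossible: each puts `v` on an induced path
    -- with three of `a`, `b`, `c`, `d`, which meets the given path but has another vertex set.
    classify : ∀ v → ¬ v ∈₄ (a , b , c , d) →
      Sees false false v a b c d ⊎ Sees true true v a b c d ⊎ Sees false true v a b c d
    classify v v∉ with adj G v a in va | adj G v b in vb | adj G v c in vc | adj G v d in vd
    ... | false | false | false | false = inj₁ (refl , refl , refl , refl)
    ... | true  | true  | true  | true  = inj₂ (inj₁ (refl , refl , refl , refl))
    ... | false | true  | true  | false = inj₂ (inj₂ (refl , refl , refl , refl))
    ... | true  | false | false | false = ⊥-elim (only-P4 v∉ (inducedP4 va ab bc vb ac vc)
                                            (inj₁ refl) (inj₂ (inj₁ refl)) (inj₁ refl))
    ... | false | false | false | true  = ⊥-elim (only-P4 v∉ (inducedP4 vd (adj-sym cd) (adj-sym bc) vc (adj-sym bd) vb)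
                                            (inj₂ (inj₁ refl)) (inj₂ (inj₂ (inj₂ refl))) (inj₁ refl))
    ... | _     | true  | false | false = ⊥-elim (only-P4 v∉ (inducedP4 vb bc cd vc bd vd)
                                            (inj₂ (inj₁ refl)) (inj₂ (inj₁ refl)) (inj₁ refl))
    ... | false | false | true  | _     = ⊥-elim (only-P4 v∉ (inducedP4 vc (adj-sym bc) (adj-sym ab) vb (adj-sym ac) va)
                                            (inj₂ (inj₁ refl)) (inj₂ (inj₂ (inj₁ refl))) (inj₁ refl))
    ... | true  | _     | true  | false = ⊥-elim (only-P4 v∉ (inducedP4 (adj-sym va) vc cd ac vd ad)
                                            (inj₁ refl) (inj₁ refl) (inj₂ (inj₁ refl)))
    ... | false | true  | _     | true  = ⊥-elim (only-P4 v∉ (inducedP4 (adj-sym vd) vb (adj-sym ab) (adj-sym bd) va (adj-sym ad))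
                                            (inj₁ refl) (inj₂ (inj₂ (inj₂ refl))) (inj₂ (inj₁ refl)))
    ... | true  | false | _     | true  = ⊥-elim (only-P4 v∉ (inducedP4 (adj-sym ab) (adj-sym va) vd (adj-sym vb) ad bd)
                                            (inj₁ refl) (inj₂ (inj₁ refl)) (inj₂ (inj₂ (inj₁ refl))))
    ... | true  | true  | false | true  = ⊥-elim (only-P4 v∉ (inducedP4 cd (adj-sym vd) va (adj-sym vc) (adj-sym ad) (adj-sym ac))
                                            (inj₁ refl) (inj₂ (inj₂ (inj₂ refl))) (inj₂ (inj₂ (inj₁ refl))))

    -- An edge would make `z`-`r`-`b`-`a` a second induced path.
    none-mid : ∀ {z r} → ¬ z ∈₄ (a , b , c , d) →
      Sees false false z a b c d → Sees false true r a b c d → adj G z r ≡ false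
    none-mid {z} {r} z∉ (za , zb , _) (ra , rb , _) with adj G z r in zr
    ... | false = refl
    ... | true = ⊥-elim (only-P4 z∉ (inducedP4 zr rb (adj-sym ab) zb ra za)
                   (inj₁ refl) (inj₂ (inj₂ (inj₂ refl))) (inj₁ refl))

    -- A missing edge would make `a`-`j`-`c`-`r` a second induced path.
    all-mid : ∀ {j r} → ¬ j ∈₄ (a , b , c , d) →
      Sees true true j a b c d → Sees false true r a b c d → adj G j r ≡ true
    all-mid {j} {r} j∉ (ja , _ , jc , _) (ra , _ , rc , _) with adj G j r in jr
    ... | true = refl
    ... | false = ⊥-elim (only-P4 j∉ (inducedP4 (adj-sym ja) jc (adj-sym rc) ac jr (adj-sym ra))
                    (inj₁ refl) (inj₁ refl) (inj₂ (inj₁ refl)))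

    module _ {rs : List (Fin n)} (rs-mid : ∀ {r} → r ∈ rs → Sees false true r a b c d)
      {v : Fin n} (v∉ : ¬ v ∈₄ (a , b , c , d)) where

      none-path : Sees false false v a b c d → ∀ {y} → y ∈ a ∷ b ∷ c ∷ d ∷ rs → adj G v y ≡ false
      none-path (va , _) (here refl) = va
      none-path (_ , vb , _) (there (here refl)) = vb
      none-path (_ , _ , vc , _) (there (there (here refl))) = vc
      none-path (_ , _ , _ , vd) (there (there (there (here refl)))) = vd
      none-path s (there (there (there (there r∈)))) = none-mid v∉ s (rs-mid r∈)

      all-path : Sees true true v a b c d → ∀ {y} → y ∈ a ∷ b ∷ c ∷ d ∷ rs → adj G v y ≡ true
      all-path (va , _) (here refl) = va
      all-path (_ , vb , _) (there (here refl)) = vb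
      all-path (_ , _ , vc , _) (there (there (here refl))) = vc
      all-path (_ , _ , _ , vd) (there (there (there (here refl)))) = vd
      all-path s (there (there (there (there r∈)))) = all-mid v∉ s (rs-mid r∈)

  -- Inserting a vertex into a decomposition

  ∈₄⇒∈ : ∀ {x a b c d : Fin n} {rs} → x ∈₄ (a , b , c , d) → x ∈ a ∷ b ∷ c ∷ d ∷ rs
  ∈₄⇒∈ (inj₁ refl) = here refl
  ∈₄⇒∈ (inj₂ (inj₁ refl)) = there (here refl)
  ∈₄⇒∈ (inj₂ (inj₂ (inj₁ refl))) = there (there (here refl))
  ∈₄⇒∈ (inj₂ (inj₂ (inj₂ refl))) = there (there (there (here refl)))

  Unique⇒∉₄ : ∀ {r a b c d : Fin n} {rs} → Unique (a ∷ b ∷ c ∷ d ∷ rs) → r ∈ rs → ¬ r ∈₄ (a , b , c , d)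
  Unique⇒∉₄ {a = a} {b} {c} {d} u r∈ r∈₄ =
    Unique-++-≢ (a ∷ b ∷ c ∷ d ∷ []) u (∈₄⇒∈ r∈₄) r∈ refl

  insert-path : P4Reducible G → ∀ {a b c d rs xs v} → IsInducedP4 G a b c d → Unique (v ∷ xs) →
    xs ↭ a ∷ b ∷ c ∷ d ∷ rs → (∀ {r} → r ∈ rs → Sees false true r a b c d) →
    Decomposition (v ∷ xs)
  insert-path red {a} {b} {c} {d} {rs} {xs} {v} P u p mid = go (classify red P v v∉)
    where
    v∉ : ¬ v ∈₄ (a , b , c , d)
    v∉ v∈ = Unique-++-≢ [ v ] u (here refl) (∈-resp-↭ (↭-sym p) (∈₄⇒∈ v∈)) refl
    go : _ → Decomposition (v ∷ xs)
    go (inj₁ s) = split-unique false v [] a (b ∷ c ∷ d ∷ rs) u (↭-prep v p)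
      λ { (here refl) → none-path red P mid v∉ s }
    go (inj₂ (inj₁ s)) = split-unique true v [] a (b ∷ c ∷ d ∷ rs) u (↭-prep v p)
      λ { (here refl) → all-path red P mid v∉ s }
    go (inj₂ (inj₂ s)) = path a b c d (v ∷ rs)
      (↭-trans (↭-prep v p) (↭-sym (shift v (a ∷ b ∷ c ∷ d ∷ []) rs))) P
      λ { (here refl) → s ; (there r∈) → mid r∈ }

  -- Adjacency to `b` tells the two types apart. Vertices that see nothing of the path, if there are
  -- any, split off from the path and from the vertices seeing its midpoints, since `none-mid`
  -- forbids edges to the latter.
  path-or-split : P4Reducible G → ∀ {a b c d rs xs} → IsInducedP4 G a b c d → Unique xs →
    xs ↭ a ∷ b ∷ c ∷ d ∷ rs →
    (∀ {r} → r ∈ rs → Sees false false r a b c d ⊎ Sees false true r a b c d) →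
    Decomposition xs
  path-or-split red {a} {b} {c} {d} {rs} {xs} P u p types with partitionᵇ-↭ (λ r → adj G r b) rs
  ... | ys , zs , q , ys-b , zs-b = go zs q zs-b
    where
    mid : ∀ {r} → r ∈ rs → adj G r b ≡ true → Sees false true r a b c d
    mid r∈ rb with types r∈
    ... | inj₁ (_ , rb′ , _) = ⊥-elim (true≢false rb rb′)
    ... | inj₂ s = s
    none : ∀ {r} → r ∈ rs → adj G r b ≡ false → Sees false false r a b c d
    none r∈ rb with types r∈
    ... | inj₁ s = s
    ... | inj₂ (_ , rb′ , _) = ⊥-elim (true≢false rb′ rb)
    go : ∀ zs → rs ↭ ys ++ zs → All (λ r → adj G r b ≡ false) zs → Decomposition xs
    go [] q _ = path a b c d rs p P λ r∈ →
      mid r∈ (All.lookup ys-b (subst (_ ∈_) (++-identityʳ ys) (∈-resp-↭ q r∈)))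
    go (z ∷ zs) q zs-b = split-unique false z zs a (b ∷ c ∷ d ∷ ys) u
      (↭-trans p (↭-trans (↭-prep a (↭-prep b (↭-prep c (↭-prep d q)))) (++-comm (a ∷ b ∷ c ∷ d ∷ ys) (z ∷ zs))))
      λ {x} x∈ → let x∈rs = ∈-resp-↭ (↭-sym q) (∈-++⁺ʳ ys x∈) in
        none-path red P
          (λ r∈ → mid (∈-resp-↭ (↭-sym q) (∈-++⁺ˡ r∈)) (All.lookup ys-b r∈))
          (Unique⇒∉₄ (Unique-resp-↭ p u) x∈rs)
          (none x∈rs (All.lookup zs-b x∈))

  module _ (red : P4Reducible G) {v : Fin n} {xs : List (Fin n)} (u : Unique (v ∷ xs)) where

    -- The path is `q`-`p`-`v`-`b`, induced because no edge joins `as` to `bs`. No vertex sees all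
    -- of it: one in `as` misses `b`, one in `bs` misses `p`, and `v` misses itself. This leaves
    -- only the types that `path-or-split` allows.
    insert-crossing : ∀ {as bs p q b} → xs ↭ as ++ bs →
      (∀ {x y} → x ∈ as → y ∈ bs → adj G x y ≡ false) →
      p ∈ as → q ∈ as → b ∈ bs →
      adj G v p ≡ true → adj G v q ≡ false → adj G p q ≡ true → adj G v b ≡ true →
      Decomposition (v ∷ xs)
    insert-crossing {as} {bs} {p} {q} {b} perm cross p∈ q∈ b∈ vp vq pq vb =
      go (extract₄ (left q∈) (left p∈) (here refl) (there (∈-resp-↭ (↭-sym perm) (∈-++⁺ʳ as b∈))) (proj₁ P))
      where
      P : IsInducedP4 G q p v b
      P = inducedP4 (adj-sym pq) (adj-sym vp) vb (adj-sym vq) (cross p∈ b∈) (cross q∈ b∈)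
      left : ∀ {x} → x ∈ as → x ∈ v ∷ xs
      left x∈ = there (∈-resp-↭ (↭-sym perm) (∈-++⁺ˡ x∈))
      not-all : ∀ {r} → r ∈ v ∷ xs → ¬ Sees true true r q p v b
      not-all (here refl) (_ , _ , rv , _) = adjacent-≢ rv refl
      not-all (there r∈) (_ , rp , _ , rb) with ∈-++⁻ as (∈-resp-↭ perm r∈)
      ... | inj₁ r∈as = true≢false rb (cross r∈as b∈)
      ... | inj₂ r∈bs = true≢false (adj-sym rp) (cross p∈ r∈bs)
      go : (∃ λ rs → v ∷ xs ↭ q ∷ p ∷ v ∷ b ∷ rs) → Decomposition (v ∷ xs)
      go (rs , perm′) = path-or-split red P u perm′ types
        where
        types : ∀ {r} → r ∈ rs → Sees false false r q p v b ⊎ Sees false true r q p v b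
        types {r} r∈ with classify red P r (Unique⇒∉₄ (Unique-resp-↭ perm′ u) r∈)
        ... | inj₁ s = inj₁ s
        ... | inj₂ (inj₂ s) = inj₂ s
        ... | inj₂ (inj₁ s) = ⊥-elim (not-all (∈-resp-↭ (↭-sym perm′) (there (there (there (there r∈))))) s)

    -- If `v` has no neighbour on one side, that side stays cut off; if `v` sees everything, it
    -- splits off in the complement. Otherwise take the neighbours `ks` and non-neighbours `m ∷ ms`
    -- of `v`. With no edge between them, the non-neighbours are cut off from `v ∷ ks`. Such an edge
    -- lies within one side, and continues through `v` to a neighbour of `v` on the other side as an
    -- induced path.
    insert-disconnected : ∀ a as b bs → xs ↭ (a ∷ as) ++ (b ∷ bs) →
      (∀ {x y} → x ∈ a ∷ as → y ∈ b ∷ bs → adj G x y ≡ false) → Decomposition (v ∷ xs)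
    insert-disconnected a as b bs perm cross
      with edges? [ v ] (a ∷ as) | edges? [ v ] (b ∷ bs) | partitionᵇ-↭ (adj G v) xs
    ... | inj₂ none | _ | _ = split-unique false a as v (b ∷ bs) u
          (↭-trans (↭-prep v perm) (↭-sym (shift v (a ∷ as) (b ∷ bs))))
          λ { x∈ (here refl) → adj-sym (none (here refl) x∈) ; x∈ (there y∈) → cross x∈ y∈ }
    ... | inj₁ _ | inj₂ none | _ = split-unique false b bs v (a ∷ as) u
          (↭-trans (↭-prep v (↭-trans perm (++-comm (a ∷ as) (b ∷ bs)))) (↭-sym (shift v (b ∷ bs) (a ∷ as))))
          λ { x∈ (here refl) → adj-sym (none (here refl) x∈) ; x∈ (there y∈) → adj-sym (cross y∈ x∈) }
    ... | inj₁ _ | inj₁ _ | ks , [] , q , ks-v , _ = split-unique true v [] a (as ++ (b ∷ bs)) u (↭-prep v perm)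
          λ { (here refl) y∈ →
              All.lookup ks-v (subst (_ ∈_) (++-identityʳ ks) (∈-resp-↭ q (∈-resp-↭ (↭-sym perm) y∈))) }
    ... | inj₁ (_ , a₀ , here refl , a₀∈ , va₀) | inj₁ (_ , b₀ , here refl , b₀∈ , vb₀) | ks , m ∷ ms , q , ks-v , ms-v
        with edges? ks (m ∷ ms)
    ...   | inj₂ none = split-unique false m ms v ks u
            (↭-trans (↭-prep v (↭-trans q (++-comm ks (m ∷ ms)))) (↭-sym (shift v (m ∷ ms) ks)))
            λ { x∈ (here refl) → adj-sym (All.lookup ms-v x∈) ; x∈ (there y∈) → adj-sym (none y∈ x∈) }
    ...   | inj₁ (x , y , x∈ , y∈ , xy)
          with ∈-++⁻ (a ∷ as) (∈-resp-↭ (↭-trans (↭-sym q) perm) (∈-++⁺ˡ x∈))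
             | ∈-++⁻ (a ∷ as) (∈-resp-↭ (↭-trans (↭-sym q) perm) (∈-++⁺ʳ ks y∈))
    ...     | inj₁ x∈A | inj₁ y∈A =
              insert-crossing perm cross x∈A y∈A b₀∈ (All.lookup ks-v x∈) (All.lookup ms-v y∈) xy vb₀
    ...     | inj₂ x∈B | inj₂ y∈B =
              insert-crossing (↭-trans perm (++-comm (a ∷ as) (b ∷ bs))) (λ x∈ y∈ → adj-sym (cross y∈ x∈))
                x∈B y∈B a₀∈ (All.lookup ks-v x∈) (All.lookup ms-v y∈) xy va₀
    ...     | inj₁ x∈A | inj₂ y∈B = ⊥-elim (true≢false xy (cross x∈A y∈B))
    ...     | inj₂ x∈B | inj₁ y∈A = ⊥-elim (true≢false xy (adj-sym (cross y∈A x∈B)))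

-- Complements

complement : ∀ {n} → Graph n → Graph n
adj (complement G) x y = not ⌊ x ≟ y ⌋ ∧ not (adj G x y)
sym (complement G) x y with x ≟ y | y ≟ x
... | yes _ | yes _ = refl
... | yes p | no ¬q = ⊥-elim (¬q (≡.sym p))
... | no ¬p | yes q = ⊥-elim (¬p (≡.sym q))
... | no _ | no _ = cong not (sym G x y)
irrefl (complement G) x with x ≟ x
... | yes _ = refl
... | no x≢x = ⊥-elim (x≢x refl)

module _ {n} (G : Graph n) where

  adj-complement : ∀ {x y} → x ≢ y → adj (complement G) x y ≡ not (adj G x y)
  adj-complement {x} {y} x≢y with x ≟ y
  ... | yes x≡y = ⊥-elim (x≢y x≡y)
  ... | no _ = refl

  adj-complement⁻ : ∀ {x y e} → x ≢ y → adj (complement G) x y ≡ e → adj G x y ≡ not e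
  adj-complement⁻ x≢y refl = trans (≡.sym (not-involutive _)) (cong not (≡.sym (adj-complement x≢y)))

  -- The path on four vertices is self-complementary, with ends and midpoints exchanged: its
  -- non-edges `bd`, `ad`, `ac` form `b`-`d`-`a`-`c`.
  path-complement⁻ : ∀ {a b c d} → IsInducedP4 (complement G) a b c d → IsInducedP4 G b d a c
  path-complement⁻ ((a≢b , a≢c , a≢d , b≢c , b≢d , c≢d) , (ab , bc , cd) , (ac , bd , ad)) =
    inducedP4 G (adj-complement⁻ b≢d bd) (adj-sym G (adj-complement⁻ a≢d ad)) (adj-complement⁻ a≢c ac)
      (adj-sym G (adj-complement⁻ a≢b ab)) (adj-sym G (adj-complement⁻ c≢d cd)) (adj-complement⁻ b≢c bc)

  ∈₄-shuffle : ∀ {x a b c d : Fin n} → x ∈₄ (a , b , c , d) ⇔ x ∈₄ (b , d , a , c)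
  ∈₄-shuffle =
    (λ { (inj₁ p) → inj₂ (inj₂ (inj₁ p)) ; (inj₂ (inj₁ p)) → inj₁ p
       ; (inj₂ (inj₂ (inj₁ p))) → inj₂ (inj₂ (inj₂ p)) ; (inj₂ (inj₂ (inj₂ p))) → inj₂ (inj₁ p) }) ,
    (λ { (inj₁ p) → inj₂ (inj₁ p) ; (inj₂ (inj₁ p)) → inj₂ (inj₂ (inj₂ p))
       ; (inj₂ (inj₂ (inj₁ p))) → inj₁ p ; (inj₂ (inj₂ (inj₂ p))) → inj₂ (inj₂ (inj₁ p)) })

  reducible-complement : P4Reducible G → P4Reducible (complement G)
  reducible-complement red v a b c d a′ b′ c′ d′ P P′ v∈ v∈′ x
    with f , g ← red v b d a c b′ d′ a′ c′ (path-complement⁻ P) (path-complement⁻ P′)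
                   (proj₁ ∈₄-shuffle v∈) (proj₁ ∈₄-shuffle v∈′) x
    = proj₂ ∈₄-shuffle ∘ f ∘ proj₁ ∈₄-shuffle , proj₂ ∈₄-shuffle ∘ g ∘ proj₁ ∈₄-shuffle

  mid⇒∉ : ∀ {a b c d r} → IsInducedP4 G a b c d → Sees G false true r a b c d →
    r ≢ a × r ≢ b × r ≢ c × r ≢ d
  mid⇒∉ (_ , _ , (ac , bd , _)) (ra , rb , rc , rd) =
    adj-≢ G rc ac , adjacent-≢ G rb , adjacent-≢ G rc , adj-≢ G rb (adj-sym G bd)

module _ {n} (G : Graph n) where

  -- A split flips its `e`. In the path case ends and midpoints trade places while adjacency to them
  -- is negated, so a vertex that sees exactly the midpoints still does.
  decomposition-complement⁻ : ∀ {xs} → Decomposition (complement G) xs → Decomposition G xs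
  decomposition-complement⁻ (single x p) = single x p
  decomposition-complement⁻ (split e a as b bs p cross) = split (not e) a as b bs p λ x∈ y∈ →
    proj₁ (cross x∈ y∈) , adj-complement⁻ G (proj₁ (cross x∈ y∈)) (proj₂ (cross x∈ y∈))
  decomposition-complement⁻ (path a b c d rs p P mid) =
    path b d a c rs
      (↭-trans p (↭-trans (shift b [ a ] (c ∷ d ∷ rs)) (↭-prep b (shift d (a ∷ c ∷ []) rs))))
      (path-complement⁻ G P) λ r∈ →
      let ra , rb , rc , rd = mid r∈
          r≢a , r≢b , r≢c , r≢d = mid⇒∉ (complement G) P (mid r∈)
      in adj-complement⁻ G r≢b rb , adj-complement⁻ G r≢d rd , adj-complement⁻ G r≢a ra , adj-complement⁻ G r≢c rc

  decompose : P4Reducible G → ∀ x xs → Unique (x ∷ xs) → Decomposition G (x ∷ xs)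
  decompose red x [] _ = single x refl
  decompose red v (x ∷ xs) u@(_ ∷ u′) with decompose red x xs u′
  ... | single .x refl = split-unique G (adj G v x) v [] x [] u ↭-refl
          λ { (here refl) (here refl) → refl }
  ... | path a b c d rs p P mid = insert-path G red P u p mid
  ... | split false a as b bs p cross = insert-disconnected G red u a as b bs p λ x∈ y∈ → proj₂ (cross x∈ y∈)
  -- The two parts have no edges between them in the complement, which is again `P₄`-reducible.
  ... | split true a as b bs p cross = decomposition-complement⁻
          (insert-disconnected (complement G) (reducible-complement G red) u a as b bs p λ x∈ y∈ →
            let x≢y , xy = cross x∈ y∈ in trans (adj-complement G x≢y) (cong not xy))

-- Frames

-- A network with root 0 whose leaves are open slots: slot s hangs below
-- attach s, one marks the label 1, and meet s s′ is the least common ancestor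
-- of two slots (junk if s ≡ s′).
record Frame : Set where
  no-eta-equality
  field
    size slots : ℕ
  Inner : Set
  Inner = Fin (suc size)
  Slot : Set
  Slot = Fin slots
  field
    arcs   : List (Inner × Inner)
    attach : Slot → Inner
    one    : Inner → Bool
    meet   : Slot → Slot → Inner

  _⟶_ _⟶⋆_ : Inner → Inner → Set
  u ⟶ v = (u , v) ∈ arcs
  _⟶⋆_ = Star _⟶_

  _⟶?_ : ∀ u v → Dec (u ⟶ v)
  u ⟶? v = DecMembership._∈?_ (≡-dec _≟_ _≟_) (u , v) arcs

  innerPreds innerSuccs : Inner → List Inner
  innerPreds v = filter (_⟶? v) (allFin _)
  innerSuccs u = filter (u ⟶?_) (allFin _)

  slotsAt : Inner → List Slot
  slotsAt u = filter (λ s → attach s ≟ u) (allFin _)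

  out : Inner → ℕ
  out u = length (innerSuccs u) + length (slotsAt u)

  -- The numbering of the vertices is a topological order. This yields acyclicity and makes the
  -- search in `reach?` terminate.
  Increasing : Set
  Increasing = ∀ u v → u ⟶ v → toℕ u < toℕ v

  increasing? : Dec Increasing
  increasing? = all? λ u → all? λ v → (u ⟶? v) →-dec (toℕ u ℕ.<? toℕ v)

  -- The fuel k bounds the number of vertices above u in the topological order.
  reach? : Increasing → ∀ k u v → suc size ≤ k + toℕ u → Dec (u ⟶⋆ v)
  reach? inc zero u v k≤u = ⊥-elim (ℕ.<⇒≱ (toℕ<n u) k≤u)
  reach? inc (suc k) u v k≤u with u ≟ v
  ... | yes refl = yes ε
  ... | no u≢v = map′ (λ { (_ , a , p) → a ◅ p }) uncons (any? next?)
    where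
    uncons : u ⟶⋆ v → ∃ λ w → u ⟶ w × w ⟶⋆ v
    uncons ε = ⊥-elim (u≢v refl)
    uncons (a ◅ p) = _ , a , p
    next? : ∀ w → Dec (u ⟶ w × w ⟶⋆ v)
    next? w with u ⟶? w
    ... | no ¬a = no (¬a ∘ proj₁)
    ... | yes a = map′ (a ,_) proj₂ (reach? inc k w v
      (ℕ.≤-trans k≤u (ℕ.≤-trans (ℕ.≤-reflexive (≡.sym (ℕ.+-suc k (toℕ u)))) (ℕ.+-monoʳ-≤ k (inc u w a)))))

  -- `one-hybrid` speaks of the whole frame, not of its blocks. `meet-least` demands a least common
  -- ancestor, which is more than a minimal one and hence unique.
  record Valid : Set where
    pattern
    constructor valid
    field
      increasing : Increasing
      from-root  : ∀ v → zero ⟶⋆ v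
      root-out   : 2 ≤ out zero
      degrees    : ∀ v → v ≢ zero →
                   (length (innerPreds v) ≡ 1 × 2 ≤ out v) ⊎ (length (innerPreds v) ≡ 2 × 1 ≤ out v)
      one-hybrid : ∀ u v → length (innerPreds u) ≡ 2 → length (innerPreds v) ≡ 2 → u ≡ v
      meet-least : ∀ s s′ → s ≢ s′ → meet s s′ ⟶⋆ attach s × meet s s′ ⟶⋆ attach s′ ×
                   (∀ u → u ⟶⋆ attach s → u ⟶⋆ attach s′ → u ⟶⋆ meet s s′)

  valid? : Dec Valid
  -- Several remaining conditions mention `⟶⋆`, whose decision procedure needs increasing arcs.
  valid? with increasing?
  ... | no ¬inc = no (¬inc ∘ Valid.increasing)
  ... | yes inc = map′
      (λ { (p , q , r , s , t) → valid inc p q r s t })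
      (λ { (valid _ p q r s t) → p , q , r , s , t })
      (all? (λ v → reach zero v)
      ×-dec (2 ℕ.≤? out zero)
      ×-dec all? (λ v → ¬? (v ≟ zero) →-dec
          (((length (innerPreds v) ℕ.≟ 1) ×-dec (2 ℕ.≤? out v)) ⊎-dec
           ((length (innerPreds v) ℕ.≟ 2) ×-dec (1 ℕ.≤? out v))))
      ×-dec all? (λ u → all? λ v →
          (length (innerPreds u) ℕ.≟ 2) →-dec ((length (innerPreds v) ℕ.≟ 2) →-dec (u ≟ v)))
      ×-dec all? (λ s → all? λ s′ → ¬? (s ≟ s′) →-dec
          (reach (meet s s′) (attach s) ×-dec (reach (meet s s′) (attach s′)
          ×-dec all? (λ u → reach u (attach s) →-dec (reach u (attach s′) →-dec reach u (meet s s′)))))))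
    where
    reach : ∀ u v → Dec (u ⟶⋆ v)
    reach u v = reach? inc (suc size) u v (ℕ.m≤m+n _ _)

-- The cherry and the two galls

cherry : Bool → Frame
cherry e = record
  { size = 0 ; slots = 2 ; arcs = [] ; attach = λ _ → 0F ; one = λ _ → e ; meet = λ _ _ → 0F }

-- In both galls, slots a, b, c, d of the path a-b-c-d hang so that b lies below
-- the hybrid vertex (the last one), a on the side 0 → 1, and c, d on the side
-- 0 → 2 → 3.  The remaining vertices, adjacent to b and c only, hang at a
-- vertex 4 inserted between 3 and the hybrid vertex, as slot 0 of gall₅.
path-meet : Fin 4 → Fin 4 → Fin 4
path-meet i j = Vec.lookup (Vec.lookup table i) j
  where
  table : Vec (Vec (Fin 4) 4) 4
  table = (1F ∷ 1F ∷ 0F ∷ 0F ∷ [])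
        ∷ (1F ∷ 2F ∷ 2F ∷ 3F ∷ [])
        ∷ (0F ∷ 2F ∷ 2F ∷ 2F ∷ [])
        ∷ (0F ∷ 3F ∷ 2F ∷ 3F ∷ [])
        ∷ []

-- `a`, `b` meet at 1 while `b`, `c` and `c`, `d` meet at 2, so 1 and 2 are labelled 1. The
-- non-edges meet at 0 (`a` with `c` or `d`) and at 3 (`b` with `d`), labelled 0. No two slots meet
-- at the hybrid vertex, so its label is arbitrary.
gall₄ : Frame
gall₄ = record
  { size = 4 ; slots = 4
  ; arcs = (0F , 1F) ∷ (1F , 4F) ∷ (0F , 2F) ∷ (2F , 3F) ∷ (3F , 4F) ∷ []
  ; attach = Vec.lookup (1F ∷ 4F ∷ 2F ∷ 3F ∷ [])
  ; one = Vec.lookup (false ∷ true ∷ true ∷ false ∷ false ∷ [])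
  ; meet = λ s s′ → inject₁ (path-meet s s′) }

-- The remaining vertices meet `b` at 4 and `c` at 2, labelled 1, but `a` at 0 and `d` at 3,
-- labelled 0. If there were none, 4 would have indegree and outdegree 1, which a galled-tree
-- forbids; hence the separate `gall₄`.
gall₅ : Frame
gall₅ = record
  { size = 5 ; slots = 5
  ; arcs = (0F , 1F) ∷ (1F , 5F) ∷ (0F , 2F) ∷ (2F , 3F) ∷ (3F , 4F) ∷ (4F , 5F) ∷ []
  ; attach = Vec.lookup (4F ∷ 1F ∷ 5F ∷ 2F ∷ 3F ∷ [])
  ; one = Vec.lookup (false ∷ true ∷ true ∷ false ∷ true ∷ false ∷ [])
  ; meet = λ
      { zero zero → 4F
      ; zero (suc j) → Vec.lookup (0F ∷ 4F ∷ 2F ∷ 3F ∷ []) j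
      ; (suc i) zero → Vec.lookup (0F ∷ 4F ∷ 2F ∷ 3F ∷ []) i
      ; (suc i) (suc j) → inject₁ (inject₁ (path-meet i j)) } }

-- Abstract, because unification would otherwise evaluate the decision procedure.
abstract
  cherry-valid : ∀ e → Frame.Valid (cherry e)
  cherry-valid e = toWitness {a? = Frame.valid? (cherry e)} tt

  gall₄-valid : Frame.Valid gall₄
  gall₄-valid = toWitness {a? = Frame.valid? gall₄} tt

  gall₅-valid : Frame.Valid gall₅
  gall₅-valid = toWitness {a? = Frame.valid? gall₅} tt

open Frame using (Inner; Slot; attach; one; meet; _⟶_; _⟶⋆_; innerPreds; innerSuccs; slotsAt; out; Valid)

-- Trees of frames

data Tree (X : Set) : Set where
  leaf : X → Tree X
  node : (F : Frame) → Valid F → (Slot F → Tree X) → Tree X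

data _∈ᵗ_ {X : Set} (x : X) : Tree X → Set where
  here : x ∈ᵗ leaf x
  at   : ∀ {F w ts} s → x ∈ᵗ ts s → x ∈ᵗ node F w ts

module _ {X : Set} where

  data Vertex : Tree X → Set where
    tip : ∀ {x} → Vertex (leaf x)
    inn : ∀ {F w ts} → Inner F → Vertex (node F w ts)
    sub : ∀ {F w ts} s → Vertex (ts s) → Vertex (node F w ts)

  root : ∀ t → Vertex t
  root (leaf x) = tip
  root (node F _ ts) = inn zero

  isRoot : ∀ t → Vertex t → Bool
  isRoot (leaf x) _ = true
  isRoot (node F _ ts) (inn zero) = true
  isRoot (node F _ ts) (inn (suc _)) = false
  isRoot (node F _ ts) (sub _ _) = false

  position : ∀ {x t} → x ∈ᵗ t → Vertex t
  position here = tip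
  position (at s p) = sub s (position p)

  label : ∀ t → Vertex t → Label
  label (leaf x) _ = odot
  label (node F _ ts) (inn u) = if one F u then lab1 else lab0
  label (node F _ ts) (sub s u) = label (ts s) u

  data Arc : ∀ t → Vertex t → Vertex t → Set where
    inner : ∀ {F w ts u v} → _⟶_ F u v → Arc (node F w ts) (inn u) (inn v)
    down  : ∀ {F w ts} s → Arc (node F w ts) (inn (attach F s)) (sub s (root (ts s)))
    below : ∀ {F w ts} s {u v} → Arc (ts s) u v → Arc (node F w ts) (sub s u) (sub s v)

  -- The relation `Arc` serves for reasoning about paths; these duplicate-free lists of the same
  -- arcs turn degrees into lengths.
  preds succs : ∀ t → Vertex t → List (Vertex t)
  preds (leaf x) _ = []
  preds (node F _ ts) (inn v) = List.map inn (innerPreds F v)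
  preds (node F _ ts) (sub s v) =
    if isRoot (ts s) v then [ inn (attach F s) ] else List.map (sub s) (preds (ts s) v)
  succs (leaf x) _ = []
  succs (node F _ ts) (inn u) =
    List.map inn (innerSuccs F u) ++ List.map (λ s → sub s (root (ts s))) (slotsAt F u)
  succs (node F _ ts) (sub s u) = List.map (sub s) (succs (ts s) u)

  isRoot-root : ∀ t → isRoot t (root t) ≡ true
  isRoot-root (leaf x) = refl
  isRoot-root (node F _ ts) = refl

  isRoot⇒≡root : ∀ t {v} → isRoot t v ≡ true → v ≡ root t
  isRoot⇒≡root (leaf x) {tip} _ = refl
  isRoot⇒≡root (node F _ ts) {inn zero} _ = refl
  isRoot⇒≡root (node F _ ts) {inn (suc _)} ()
  isRoot⇒≡root (node F _ ts) {sub _ _} ()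

  -- No arc enters the root: frame arcs increase, so none ends at 0, and every other arc ends inside
  -- a subtree.
  root-source : ∀ t {u v} → Arc t u v → isRoot t v ≡ false
  root-source (node F w ts) (inner {v = zero} a) with () ← Valid.increasing w _ _ a
  root-source (node F w ts) (inner {v = suc _} a) = refl
  root-source (node F w ts) (down s) = refl
  root-source (node F w ts) (below s a) = refl

  module _ {F : Frame} {w : Valid F} {ts : Slot F → Tree X} where

    inn-injective : ∀ {u v} → inn {w = w} {ts} u ≡ inn v → u ≡ v
    inn-injective refl = refl

    sub-injectiveˡ : ∀ {s s′ u v} → sub {w = w} {ts} s u ≡ sub s′ v → s ≡ s′
    sub-injectiveˡ refl = refl

    sub-injectiveʳ : ∀ {s u v} → sub {w = w} {ts} s u ≡ sub s v → u ≡ v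
    sub-injectiveʳ refl = refl

  Arc⇒∈preds : ∀ t {u v} → Arc t u v → u ∈ preds t v
  Arc⇒∈preds (node F w ts) (inner {u = u} {v} a) = ∈-map⁺ inn (∈-filter⁺ (λ u → Frame._⟶?_ F u v) (∈-allFin u) a)
  Arc⇒∈preds (node F w ts) (down s) rewrite isRoot-root (ts s) = here refl
  Arc⇒∈preds (node F w ts) (below s a) rewrite root-source (ts s) a = ∈-map⁺ _ (Arc⇒∈preds (ts s) a)

  ∈preds⇒Arc : ∀ t {u v} → u ∈ preds t v → Arc t u v
  ∈preds⇒Arc (node F w ts) {v = inn v} u∈ with _ , u∈′ , refl ← ∈-map⁻ inn u∈ =
    inner (proj₂ (∈-filter⁻ (λ u → Frame._⟶?_ F u v) {xs = allFin _} u∈′))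
  ∈preds⇒Arc (node F w ts) {v = sub s v} u∈ with isRoot (ts s) v in r
  ∈preds⇒Arc (node F w ts) {v = sub s v} (here refl) | true
    with refl ← isRoot⇒≡root (ts s) r = down s
  ... | false with _ , u∈′ , refl ← ∈-map⁻ _ u∈ = below s (∈preds⇒Arc (ts s) u∈′)

  Arc⇒∈succs : ∀ t {u v} → Arc t u v → v ∈ succs t u
  Arc⇒∈succs (node F w ts) (inner {u = u} {v} a) = ∈-++⁺ˡ (∈-map⁺ inn (∈-filter⁺ (Frame._⟶?_ F u) (∈-allFin v) a))
  Arc⇒∈succs (node F w ts) (down s) =
    ∈-++⁺ʳ (List.map inn (innerSuccs F _)) (∈-map⁺ _ (∈-filter⁺ (λ s′ → attach F s′ ≟ attach F s) (∈-allFin s) refl))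
  Arc⇒∈succs (node F w ts) (below s a) = ∈-map⁺ _ (Arc⇒∈succs (ts s) a)

  ∈succs⇒Arc : ∀ t {u v} → v ∈ succs t u → Arc t u v
  ∈succs⇒Arc (node F w ts) {inn u} v∈ with ∈-++⁻ (List.map inn (innerSuccs F u)) v∈
  ... | inj₁ v∈′ with _ , v∈″ , refl ← ∈-map⁻ inn v∈′ =
        inner (proj₂ (∈-filter⁻ (Frame._⟶?_ F u) {xs = allFin _} v∈″))
  ... | inj₂ v∈′ with s , s∈ , refl ← ∈-map⁻ _ v∈′
                 with refl ← proj₂ (∈-filter⁻ (λ s′ → attach F s′ ≟ u) {xs = allFin _} s∈) = down s
  ∈succs⇒Arc (node F w ts) {sub s u} v∈ with _ , v∈′ , refl ← ∈-map⁻ _ v∈ =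
    below s (∈succs⇒Arc (ts s) v∈′)

  preds-unique : ∀ t v → Unique (preds t v)
  preds-unique (leaf x) _ = []
  preds-unique (node F w ts) (inn v) =
    Unique.map⁺ inn-injective (Unique.filter⁺ (λ u → Frame._⟶?_ F u v) (Unique.allFin⁺ _))
  preds-unique (node F w ts) (sub s v) with isRoot (ts s) v
  ... | true = [] ∷ []
  ... | false = Unique.map⁺ sub-injectiveʳ (preds-unique (ts s) v)

  succs-unique : ∀ t u → Unique (succs t u)
  succs-unique (leaf x) _ = []
  succs-unique (node F w ts) (inn u) = Unique.++⁺
    (Unique.map⁺ inn-injective (Unique.filter⁺ (Frame._⟶?_ F u) (Unique.allFin⁺ _)))
    (Unique.map⁺ (sub-injectiveˡ) (Unique.filter⁺ (λ s → attach F s ≟ u) (Unique.allFin⁺ _)))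
    disjoint
    where
    disjoint : ∀ {v : Vertex (node F w ts)} →
      ¬ (v ∈ List.map inn (innerSuccs F u) × v ∈ List.map (λ s → sub s (root (ts s))) (slotsAt F u))
    disjoint (p , q) with _ , _ , refl ← ∈-map⁻ inn p with _ , _ , () ← ∈-map⁻ _ q
  succs-unique (node F w ts) (sub s u) = Unique.map⁺ sub-injectiveʳ (succs-unique (ts s) u)

  -- Degrees

  Branching : ∀ t → Vertex t → Set
  Branching t v = (length (preds t v) ≡ 1 × 2 ≤ length (succs t v)) ⊎ (length (preds t v) ≡ 2 × 1 ≤ length (succs t v))

  -- The condition on the indegree is restricted to non-roots because a lone tip is its own root; it
  -- gains its single predecessor once it hangs in a slot.
  IsLeaf : ∀ t → Vertex t → Set
  IsLeaf t v = (∃ λ x → Σ (x ∈ᵗ t) λ p → position p ≡ v) × label t v ≡ odot × length (succs t v) ≡ 0 ×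
    (isRoot t v ≡ false → length (preds t v) ≡ 1)

  IsInner : ∀ t → Vertex t → Set
  IsInner t v = label t v ≢ odot × (isRoot t v ≡ true → 2 ≤ length (succs t v)) × (isRoot t v ≡ false → Branching t v)

  -- Hanging a subtree in a slot changes only the indegree of its root, from 0 to 1. A root with two
  -- successors thereby becomes an ordinary branching vertex.
  leaf-or-inner : ∀ t v → IsLeaf t v ⊎ IsInner t v
  leaf-or-inner (leaf x) tip = inj₁ ((x , here , refl) , refl , refl , λ ())
  leaf-or-inner (node F w ts) (inn v) = inj₂ (not-odot , root-case v , other-case v)
    where
    not-odot : (if one F v then lab1 else lab0) ≢ odot
    not-odot with one F v
    ... | true = λ ()
    ... | false = λ ()
    out-length : ∀ u → out F u ≡ length (succs (node F w ts) (inn u))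
    out-length u = ≡.sym (trans (length-++ (List.map (inn {w = w} {ts}) (innerSuccs F u)))
      (≡.cong₂ _+_ (length-map (inn {w = w} {ts}) (innerSuccs F u)) (length-map (λ s → sub {w = w} {ts} s (root (ts s))) (slotsAt F u))))
    root-case : ∀ u → isRoot (node F w ts) (inn u) ≡ true → 2 ≤ length (succs (node F w ts) (inn u))
    root-case zero _ = subst (2 ≤_) (out-length zero) (Valid.root-out w)
    other-case : ∀ u → isRoot (node F w ts) (inn u) ≡ false → Branching (node F w ts) (inn u)
    other-case (suc u) _ with Valid.degrees w (suc u) (λ ())
    ... | inj₁ (p , q) = inj₁ (trans (length-map (inn {w = w} {ts}) (innerPreds F (suc u))) p , subst (2 ≤_) (out-length (suc u)) q)
    ... | inj₂ (p , q) = inj₂ (trans (length-map (inn {w = w} {ts}) (innerPreds F (suc u))) p , subst (1 ≤_) (out-length (suc u)) q)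
  leaf-or-inner (node F w ts) (sub s v)
    with leaf-or-inner (ts s) v | isRoot (ts s) v in r
  ... | inj₁ ((x , p , refl) , l , o , i) | true = inj₁ ((x , at s p , refl) , l , trans (length-map (sub {w = w} {ts} s) (succs (ts s) (position p))) o , λ _ → refl)
  ... | inj₁ ((x , p , refl) , l , o , i) | false =
        inj₁ ((x , at s p , refl) , l , trans (length-map (sub {w = w} {ts} s) (succs (ts s) (position p))) o , λ _ → trans (length-map (sub {w = w} {ts} s) (preds (ts s) (position p))) (i r))
  ... | inj₂ (l , o , b) | true =
        inj₂ (l , (λ ()) , λ _ → inj₁ (refl , subst (2 ≤_) (≡.sym (length-map (sub {w = w} {ts} s) (succs (ts s) v))) (o r)))
  ... | inj₂ (l , o , b) | false = inj₂ (l , (λ ()) , λ _ → Sum.map lift lift (b r))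
    where
    lift : ∀ {i o} → length (preds (ts s) v) ≡ i × o ≤ length (succs (ts s) v) →
      length (List.map (sub {w = w} {ts} s) (preds (ts s) v)) ≡ i × o ≤ length (List.map (sub {w = w} {ts} s) (succs (ts s) v))
    lift (p , q) = trans (length-map (sub {w = w} {ts} s) (preds (ts s) v)) p , subst (_ ≤_) (≡.sym (length-map (sub {w = w} {ts} s) (succs (ts s) v))) q

  -- Reachability

  Reaches : ∀ t → Vertex t → Vertex t → Set
  Reaches t = Star (Arc t)

  module _ {F : Frame} {w : Valid F} {ts : Slot F → Tree X} where

    private
      t = node F w ts

    inner⁺ : ∀ {u v} → _⟶⋆_ F u v → Reaches t (inn u) (inn v)
    inner⁺ = gmap inn inner

    below⁺ : ∀ {s u v} → Reaches (ts s) u v → Reaches t (sub s u) (sub s v)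
    below⁺ {s} = gmap (sub s) (below s)

    -- No arc leaves a subtree.
    below⁻ : ∀ {s u v} → Reaches t (sub s u) v → ∃ λ v′ → v ≡ sub s v′ × Reaches (ts s) u v′
    below⁻ ε = _ , refl , ε
    below⁻ (below s a ◅ p) with _ , refl , q ← below⁻ p = _ , refl , a ◅ q

    inner⁻ : ∀ {u v} → Reaches t (inn u) (inn v) → _⟶⋆_ F u v
    inner⁻ ε = ε
    inner⁻ (inner a ◅ p) = a ◅ inner⁻ p
    inner⁻ (down s ◅ p) with _ , () , _ ← below⁻ p

    down⁻ : ∀ {u s v} → Reaches t (inn u) (sub s v) → _⟶⋆_ F u (attach F s)
    down⁻ (inner a ◅ p) = a ◅ down⁻ p
    down⁻ (down s ◅ p) with _ , refl , _ ← below⁻ p = ε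

  reaches-from-root : ∀ t v → Reaches t (root t) v
  down⁺ : ∀ {F w ts u s} v → _⟶⋆_ F u (attach F s) → Reaches (node F w ts) (inn u) (sub s v)

  reaches-from-root (leaf x) tip = ε
  reaches-from-root (node F w ts) (inn v) = inner⁺ (Valid.from-root w v)
  reaches-from-root (node F w ts) (sub s v) = down⁺ v (Valid.from-root w (attach F s))
  down⁺ {ts = ts} {s = s} v p = inner⁺ p ◅◅ down s ◅ below⁺ (reaches-from-root (ts s) v)

  acyclic : ∀ t {u v} → Arc t u v → ¬ Reaches t v u
  acyclic (node F w ts) (inner a) p = ℕ.<⇒≱ (Valid.increasing w _ _ a) (increasing⋆ (inner⁻ p))
    where
    increasing⋆ : ∀ {u v} → _⟶⋆_ F u v → toℕ u ≤ toℕ v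
    increasing⋆ ε = ℕ.≤-refl
    increasing⋆ (a ◅ p) = ℕ.≤-trans (ℕ.<⇒≤ (Valid.increasing w _ _ a)) (increasing⋆ p)
  acyclic (node F w ts) (down s) p with _ , () , _ ← below⁻ p
  acyclic (node F w ts) (below s {u} a) p with _ , refl , q ← below⁻ {w = w} {ts} {v = sub s u} p = acyclic (ts s) a q

  -- Every common ancestor is required to lie above `a`. By antisymmetry this gives both existence
  -- and uniqueness of the minimal common ancestor in `IsLca`.
  Least : ∀ t → Vertex t → Vertex t → Vertex t → Set
  Least t u v a = Reaches t a u × Reaches t a v × (∀ b → Reaches t b u → Reaches t b v → Reaches t b a)

  -- A common ancestor in the frame reaches the attachment vertex of the slot, and from there the
  -- whole subtree, including `a`.
  least-below : ∀ {F w ts} s {u v a} → Least (ts s) u v a →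
    Least (node F w ts) (sub s u) (sub s v) (sub s a)
  least-below {F} {w} {ts} s {u} {v} {a} (au , av , least) = below⁺ au , below⁺ av , least′
    where
    t = node F w ts
    least′ : ∀ b → Reaches t b (sub s u) → Reaches t b (sub s v) → Reaches t b (sub s a)
    least′ (inn b) bu bv = down⁺ a (down⁻ bu)
    least′ (sub _ b) bu bv
      with _ , refl , p ← below⁻ {v = sub s u} bu
      with _ , refl , q ← below⁻ {v = sub s v} bv = below⁺ (least _ p q)

  -- No vertex of one subtree reaches another, so common ancestors lie in the frame and are
  -- ancestors of both attachment vertices.
  least-meet : ∀ {F w ts s s′} u v → s ≢ s′ →
    Least (node F w ts) (sub s u) (sub s′ v) (inn (meet F s s′))
  least-meet {F} {w} {ts} {s} {s′} u v s≢s′ with p , q , least ← Valid.meet-least w _ _ s≢s′ =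
    down⁺ u p , down⁺ v q , least′
    where
    t = node F w ts
    least′ : ∀ b → Reaches t b (sub s u) → Reaches t b (sub s′ v) → Reaches t b (inn (meet F s s′))
    least′ (inn b) bu bv = inner⁺ (least b (down⁻ bu) (down⁻ bv))
    least′ (sub _ b) bu bv
      with _ , refl , _ ← below⁻ {v = sub s u} bu
      with _ , refl , _ ← below⁻ {v = sub s′ v} bv = ⊥-elim (s≢s′ refl)

  -- Hybrid vertices

  IsHybrid : ∀ t → Vertex t → Set
  IsHybrid t v = length (preds t v) ≡ 2

  -- A two-colouring constant along arcs that avoid `cut`: it certifies that no path between `h` and
  -- `h′` avoids `cut` without any path being examined.
  record Separation (t : Tree X) (h h′ : Vertex t) : Set where
    field
      cut    : Vertex t
      side   : Vertex t → Bool
      closed : ∀ {u v} → Arc t u v → u ≢ cut → v ≢ cut → side u ≡ side v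
      h≢cut  : h ≢ cut
      h′≢cut : h′ ≢ cut
      apart  : side h ≢ side h′

  hybrid≢root : ∀ t {h} → IsHybrid t h → isRoot t h ≡ false
  hybrid≢root t {h} hyb with preds t h in e
  ... | u ∷ _ = root-source t (∈preds⇒Arc t (subst (u ∈_) (≡.sym e) (here refl)))

  module _ {F : Frame} {w : Valid F} {ts : Slot F → Tree X} where

    private
      t = node F w ts

    -- The root of a subtree has only its attachment vertex as predecessor, so it is not hybrid; all
    -- other vertices keep their indegree.
    hybrid-below : ∀ {s v} → IsHybrid t (sub s v) → IsHybrid (ts s) v
    hybrid-below {s} {v} hyb with isRoot (ts s) v
    ... | true with () ← hyb
    ... | false = trans (≡.sym (length-map (sub {w = w} {ts} s) (preds (ts s) v))) hyb

    inSlot : Slot F → Vertex t → Bool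
    inSlot s (inn _) = false
    inSlot s (sub s′ _) = does (s′ ≟ s)

    -- The root of a subtree cuts that subtree off.
    separate-slot : ∀ {s v h′} → IsHybrid t (sub s v) → inSlot s h′ ≡ false →
      Separation t (sub s v) h′
    separate-slot {s} {v} {h′} hyb outside = record
      { cut = sub s (root (ts s))
      ; side = inSlot s
      ; closed = closed
      ; h≢cut = λ { refl → true≢false (isRoot-root (ts s)) (hybrid≢root (ts s) (hybrid-below hyb)) }
      ; h′≢cut = λ { refl → true≢false inside outside }
      ; apart = λ e → true≢false (trans (≡.sym e) inside) outside }
      where
      inside : does (s ≟ s) ≡ true
      inside = dec-true (s ≟ s) refl
      closed : ∀ {u v} → Arc t u v → u ≢ sub s (root (ts s)) → v ≢ sub s (root (ts s)) → inSlot s u ≡ inSlot s v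
      closed (inner _) _ _ = refl
      closed (below _ _) _ _ = refl
      closed (down s′) _ v≢ with s′ ≟ s
      ... | yes refl = ⊥-elim (v≢ refl)
      ... | no _ = refl

    -- Everything outside slot `s` takes the colour of the root of that subtree, since the arc into
    -- this root is the only connection.
    separate-below : ∀ {s h h′} → Separation (ts s) h h′ → Separation t (sub s h) (sub s h′)
    separate-below {s} {h} {h′} S = record
      { cut = sub s cut
      ; side = side′
      ; closed = closed′
      ; h≢cut = h≢cut ∘ sub-injectiveʳ
      ; h′≢cut = h′≢cut ∘ sub-injectiveʳ
      ; apart = λ e → apart (trans (≡.sym (side′-below h)) (trans e (side′-below h′))) }
      where
      open Separation S
      side′ : Vertex t → Bool
      side′ (inn _) = side (root (ts s))
      side′ (sub s′ v) with s′ ≟ s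
      ... | yes refl = side v
      ... | no _ = side (root (ts s))
      side′-below : ∀ v → side′ (sub s v) ≡ side v
      side′-below v with s ≟ s
      ... | yes refl = refl
      ... | no s≢s = ⊥-elim (s≢s refl)
      closed′ : ∀ {u v} → Arc t u v → u ≢ sub s cut → v ≢ sub s cut → side′ u ≡ side′ v
      closed′ (inner _) _ _ = refl
      closed′ (down s′) _ v≢ with s′ ≟ s
      ... | yes refl = refl
      ... | no _ = refl
      closed′ (below s′ a) u≢ v≢ with s′ ≟ s
      ... | yes refl = closed a (λ { refl → u≢ refl }) (λ { refl → v≢ refl })
      ... | no _ = refl

  separation-sym : ∀ {t h h′} → Separation t h h′ → Separation t h′ h
  separation-sym S = record
    { cut = cut ; side = side ; closed = closed ; h≢cut = h′≢cut ; h′≢cut = h≢cut ; apart = ≢-sym apart }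
    where open Separation S

  hybrids-separated : ∀ t {h h′} → IsHybrid t h → IsHybrid t h′ → h ≡ h′ ⊎ Separation t h h′
  hybrids-separated (node F w ts) {inn u} {inn v} p q = inj₁ (cong inn (Valid.one-hybrid w u v
    (trans (≡.sym (length-map (inn {w = w} {ts}) (innerPreds F u))) p) (trans (≡.sym (length-map (inn {w = w} {ts}) (innerPreds F v))) q)))
  hybrids-separated (node F w ts) {inn u} {sub s v} p q = inj₂ (separation-sym (separate-slot q refl))
  hybrids-separated (node F w ts) {sub s u} {inn v} p q = inj₂ (separate-slot p refl)
  hybrids-separated (node F w ts) {sub s u} {sub s′ v} p q with s′ ≟ s
  ... | yes refl = Sum.map (cong (sub s)) separate-below
        (hybrids-separated (ts s) (hybrid-below {w = w} {ts} {s} {u} p) (hybrid-below {w = w} {ts} {s} {v} q))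
  ... | no s′≢s = inj₂ (separate-slot p (dec-false (s′ ≟ s) s′≢s))

-- Trees explaining a graph

module _ {n} (G : Graph n) where

  -- Adjacency across slots depends on the slots alone. The clause `x ≢ y` makes every graph vertex
  -- occur at no more than one tip.
  data Explained : Tree (Fin n) → Set where
    leaf : ∀ {x} → Explained (leaf x)
    node : ∀ {F w ts} → (∀ s → Explained (ts s)) →
      (∀ {s s′ x y} → s ≢ s′ → x ∈ᵗ ts s → y ∈ᵗ ts s′ → x ≢ y × adj G x y ≡ one F (meet F s s′)) →
      Explained (node F w ts)

  position-unique : ∀ {t x} → Explained t → (p q : x ∈ᵗ t) → position p ≡ position q
  position-unique leaf here here = refl
  position-unique (node es cross) (at s p) (at s′ q) with s ≟ s′
  ... | yes refl = cong (sub s) (position-unique (es s) p q)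
  ... | no s≢s′ = ⊥-elim (proj₁ (cross s≢s′ p q) refl)

  position-injective : ∀ {t : Tree (Fin n)} {x y} (p : x ∈ᵗ t) (q : y ∈ᵗ t) → position p ≡ position q → x ≡ y
  position-injective here here _ = refl
  position-injective (at s p) (at s′ q) e with refl ← sub-injectiveˡ e =
    position-injective p q (sub-injectiveʳ e)

  label-position : ∀ {t : Tree (Fin n)} {x} (p : x ∈ᵗ t) → label t (position p) ≡ odot
  label-position here = refl
  label-position (at s p) = label-position p

  lca : ∀ {t x y} → Explained t → (p : x ∈ᵗ t) (q : y ∈ᵗ t) → x ≢ y →
    ∃ λ a → Least t (position p) (position q) a × label t a ≡ (if adj G x y then lab1 else lab0)
  lca leaf here here x≢y = ⊥-elim (x≢y refl)
  lca (node es cross) (at s p) (at s′ q) x≢y with s ≟ s′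
  ... | yes refl with a , least , l ← lca (es s) p q x≢y = sub s a , least-below s least , l
  ... | no s≢s′ = _ , least-meet _ _ s≢s′ , cong (if_then lab1 else lab0) (≡.sym (proj₂ (cross s≢s′ p q)))

-- Finiteness

Finite : Set → Set
Finite A = ∃ λ m → A ↔ Fin m

finite-↔ : ∀ {A B : Set} → A ↔ B → Finite B → Finite A
finite-↔ f (m , g) = m , g ↔-∘ f

finite-⊎ : ∀ {A B : Set} → Finite A → Finite B → Finite (A ⊎ B)
finite-⊎ (m , f) (n , g) = m + n , ↔-sym +↔⊎ ↔-∘ (f ⊎-↔ g)

finite-Σ : ∀ k {P : Fin k → Set} → (∀ s → Finite (P s)) → Finite (Σ (Fin k) P)
finite-Σ zero _ = 0 , mk↔ₛ′ (λ ()) (λ ()) (λ ()) (λ ())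
finite-Σ (suc k) {P} finite = finite-↔ split-zero (finite-⊎ (finite zero) (finite-Σ k (finite ∘ suc)))
  where
  split-zero : Σ (Fin (suc k)) P ↔ (P zero ⊎ Σ (Fin k) (P ∘ suc))
  split-zero = mk↔ₛ′
    (λ { (zero , p) → inj₁ p ; (suc s , p) → inj₂ (s , p) })
    (λ { (inj₁ p) → zero , p ; (inj₂ (s , p)) → suc s , p })
    (λ { (inj₁ _) → refl ; (inj₂ _) → refl })
    (λ { (zero , _) → refl ; (suc _ , _) → refl })

finite-Vertex : ∀ {X : Set} (t : Tree X) → Finite (Vertex t)
finite-Vertex (leaf x) = 1 , mk↔ₛ′ (λ _ → zero) (λ _ → tip) (λ { zero → refl }) (λ { tip → refl })
finite-Vertex (node F w ts) = finite-↔
  (mk↔ₛ′ to from (λ { (inj₁ _) → refl ; (inj₂ _) → refl }) (λ { (inn _) → refl ; (sub _ _) → refl }))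
  (finite-⊎ (_ , ↔-id _) (finite-Σ _ (λ s → finite-Vertex (ts s))))
  where
  to : Vertex (node F w ts) → Inner F ⊎ Σ (Slot F) (Vertex ∘ ts)
  to (inn u) = inj₁ u
  to (sub s u) = inj₂ (s , u)
  from : Inner F ⊎ Σ (Slot F) (Vertex ∘ ts) → Vertex (node F w ts)
  from (inj₁ u) = inn u
  from (inj₂ (s , u)) = sub s u

does-true : ∀ {A : Set} (d : Dec A) → does d ≡ true → A
does-true (yes a) _ = a

-- The indices counted and `ys` are duplicate-free lists with the same elements, hence permutations
-- of each other.
sum-indicator : ∀ {m} (f : Fin m → Bool) ys → Unique ys →
  (∀ i → f i ≡ true → i ∈ ys) → (∀ {i} → i ∈ ys → f i ≡ true) →
  sum (List.map (λ i → if f i then 1 else 0) (allFin m)) ≡ length ys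
sum-indicator {m} f ys u f⇒∈ ∈⇒f = trans (sum-length (allFin m))
  (↭-length (∼bag⇒↭ (unique∧set⇒bag (Unique.filter⁺ f? (Unique.allFin⁺ m)) u (mk⇔
    (λ i∈ → f⇒∈ _ (proj₂ (∈-filter⁻ f? {xs = allFin m} i∈)))
    (λ i∈ → ∈-filter⁺ f? (∈-allFin _) (∈⇒f i∈))))))
  where
  f? : ∀ i → Dec (f i ≡ true)
  f? i = f i Bool.≟ true
  sum-length : ∀ is → sum (List.map (λ i → if f i then 1 else 0) is) ≡ length (filter f? is)
  sum-length [] = refl
  sum-length (i ∷ is) with f i
  ... | true = cong suc (sum-length is)
  ... | false = sum-length is

-- From trees to galled-trees

module _ {n} (G : Graph n) (t : Tree (Fin n)) (explained : Explained G t) (all : ∀ x → x ∈ᵗ t) where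

  m : ℕ
  m = proj₁ (finite-Vertex t)

  open Inverse (proj₂ (finite-Vertex t))
    renaming (to to index; from to vertex; strictlyInverseˡ to index-vertex; strictlyInverseʳ to vertex-index)

  vertex-injective : ∀ {i j} → vertex i ≡ vertex j → i ≡ j
  vertex-injective {i} {j} e = trans (≡.sym (index-vertex i)) (trans (cong index e) (index-vertex j))

  index-injective : ∀ {u v} → index u ≡ index v → u ≡ v
  index-injective {u} {v} e = trans (≡.sym (vertex-index u)) (trans (cong vertex e) (vertex-index v))

  _≟ᵛ_ : DecidableEquality (Vertex t)
  _≟ᵛ_ = via-injection (↔⇒↣ (proj₂ (finite-Vertex t))) _≟_

  arc? : ∀ i j → Dec (vertex i ∈ preds t (vertex j))
  arc? i j = DecMembership._∈?_ _≟ᵛ_ (vertex i) (preds t (vertex j))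

  network : Digraph m
  network = record { arc = λ i j → does (arc? i j) }

  arc⇒Arc : ∀ {i j} → arc network i j ≡ true → Arc t (vertex i) (vertex j)
  arc⇒Arc {i} {j} a = ∈preds⇒Arc t (does-true (arc? i j) a)

  Arc⇒arc : ∀ {i j} → Arc t (vertex i) (vertex j) → arc network i j ≡ true
  Arc⇒arc {i} {j} a = dec-true (arc? i j) (Arc⇒∈preds t a)

  ∈-map-index⁺ : ∀ {i us} → vertex i ∈ us → i ∈ List.map index us
  ∈-map-index⁺ {i} p = subst (_∈ _) (index-vertex i) (∈-map⁺ index p)

  ∈-map-index⁻ : ∀ {i us} → i ∈ List.map index us → vertex i ∈ us
  ∈-map-index⁻ p with u , u∈ , refl ← ∈-map⁻ index p = subst (_∈ _) (≡.sym (vertex-index u)) u∈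

  indegree : ∀ i → indeg network i ≡ length (preds t (vertex i))
  indegree i = trans
    (sum-indicator (λ j → arc network j i) (List.map index (preds t (vertex i)))
      (Unique.map⁺ index-injective (preds-unique t (vertex i)))
      (λ j a → ∈-map-index⁺ (Arc⇒∈preds t (arc⇒Arc {j} {i} a)))
      (λ {j} j∈ → Arc⇒arc {j} {i} (∈preds⇒Arc t (∈-map-index⁻ j∈))))
    (length-map index (preds t (vertex i)))

  outdegree : ∀ i → outdeg network i ≡ length (succs t (vertex i))
  outdegree i = trans
    (sum-indicator (arc network i) (List.map index (succs t (vertex i)))
      (Unique.map⁺ index-injective (succs-unique t (vertex i)))
      (λ j a → ∈-map-index⁺ (Arc⇒∈succs t (arc⇒Arc {i} {j} a)))
      (λ {j} j∈ → Arc⇒arc {i} {j} (∈succs⇒Arc t (∈-map-index⁻ j∈))))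
    (length-map index (succs t (vertex i)))

  reach⇒Reaches : ∀ {i j} → Reach network i j → Reaches t (vertex i) (vertex j)
  reach⇒Reaches here = ε
  reach⇒Reaches (step a p) = arc⇒Arc a ◅ reach⇒Reaches p

  Reaches⇒reach : ∀ {i j} → Reaches t (vertex i) (vertex j) → Reach network i j
  Reaches⇒reach p = subst₂ (Reach network) (index-vertex _) (index-vertex _) (go p)
    where
    go : ∀ {u v} → Reaches t u v → Reach network (index u) (index v)
    go ε = here
    go (_◅_ {u} {v} a p) = step
      (Arc⇒arc (subst₂ (Arc t) (≡.sym (vertex-index u)) (≡.sym (vertex-index v)) a)) (go p)

  leafIndex : Fin n → Fin m
  leafIndex x = index (position (all x))

  vertex-leafIndex : ∀ x → vertex (leafIndex x) ≡ position (all x)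
  vertex-leafIndex x = vertex-index (position (all x))

  leafIndex-injective : ∀ {x y} → leafIndex x ≡ leafIndex y → x ≡ y
  leafIndex-injective e = position-injective G (all _) (all _) (index-injective e)

  labelling : Fin m → Label
  labelling i = label t (vertex i)

  label-leafIndex : ∀ x → labelling (leafIndex x) ≡ odot
  label-leafIndex x rewrite vertex-leafIndex x = label-position G (all x)

  IsLeaf⇒InX : ∀ {i} → IsLeaf t (vertex i) → InX leafIndex i
  IsLeaf⇒InX ((x , p , e) , _) = x , vertex-injective
    (trans (vertex-leafIndex x) (trans (position-unique G explained (all x) p) e))

  valid-labelling : ValidLabeling leafIndex labelling
  valid-labelling i = odot⇒InX , λ { (x , refl) → label-leafIndex x }
    where
    odot⇒InX : labelling i ≡ odot → InX leafIndex i
    odot⇒InX l with leaf-or-inner t (vertex i)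
    ... | inj₁ isLeaf = IsLeaf⇒InX isLeaf
    ... | inj₂ (l≢odot , _) = ⊥-elim (l≢odot l)

  reach-leaf⁺ : ∀ {a x} → Reaches t a (position (all x)) → Reach network (index a) (leafIndex x)
  reach-leaf⁺ {a} {x} p =
    Reaches⇒reach (subst₂ (Reaches t) (≡.sym (vertex-index a)) (≡.sym (vertex-leafIndex x)) p)

  reach-leaf⁻ : ∀ {i x} → Reach network i (leafIndex x) → Reaches t (vertex i) (position (all x))
  reach-leaf⁻ {x = x} p = subst (Reaches t _) (vertex-leafIndex x) (reach⇒Reaches p)

  Reaches-antisym : ∀ {u v} → Reaches t u v → Reaches t v u → u ≡ v
  Reaches-antisym ε _ = refl
  Reaches-antisym (a ◅ p) q = ⊥-elim (acyclic t a (p ◅◅ q))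

  Least⇒IsLca : ∀ {x y a} → Least t (position (all x)) (position (all y)) a →
    IsLca network (leafIndex x) (leafIndex y) (index a)
  Least⇒IsLca {a = a} (ax , ay , least) = reach-leaf⁺ ax , reach-leaf⁺ ay , λ b bx by ab →
    trans (≡.sym (index-vertex b)) (cong index (Reaches-antisym
      (least _ (reach-leaf⁻ bx) (reach-leaf⁻ by))
      (subst (λ a → Reaches t a _) (vertex-index a) (reach⇒Reaches ab))))

  -- The least common ancestor `a` lies below `b`, so minimality of `b` forces equality.
  IsLca⇒≡ : ∀ {x y a b} → Least t (position (all x)) (position (all y)) a →
    IsLca network (leafIndex x) (leafIndex y) b → index a ≡ b
  IsLca⇒≡ {a = a} (ax , ay , least) (bx , by , minimal) =
    minimal (index a) (reach-leaf⁺ ax) (reach-leaf⁺ ay) (Reaches⇒reach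
      (subst (Reaches t _) (≡.sym (vertex-index a)) (least _ (reach-leaf⁻ bx) (reach-leaf⁻ by))))

  explains : Explains G network leafIndex labelling
  explains x y = adjacent⇒lca , lca⇒adjacent
    where
    lab1⇒true : ∀ {e} → (if e then lab1 else lab0) ≡ lab1 → e ≡ true
    lab1⇒true {true} _ = refl
    adjacent⇒lca : adj G x y ≡ true → ∃ λ a → IsLca network (leafIndex x) (leafIndex y) a × labelling a ≡ lab1
    adjacent⇒lca xy with a , least , l ← lca G explained (all x) (all y) (adjacent-≢ G xy) =
      index a , Least⇒IsLca least ,
      trans (cong (label t) (vertex-index a)) (trans l (cong (if_then lab1 else lab0) xy))
    lca⇒adjacent : (∃ λ a → IsLca network (leafIndex x) (leafIndex y) a × labelling a ≡ lab1) → adj G x y ≡ true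
    lca⇒adjacent (b , isLca@(bx , by , minimal) , l) with x ≟ y
    -- A leaf is its own only minimal common ancestor and carries `odot`, so no loop is explained.
    ... | yes refl with refl ← minimal _ here here bx with () ← trans (≡.sym l) (label-leafIndex x)
    ... | no x≢y with a , least , la ← lca G explained (all x) (all y) x≢y with refl ← IsLca⇒≡ least isLca =
      lab1⇒true (trans (≡.sym la) (trans (cong (label t) (≡.sym (vertex-index a))) l))

  -- Degree and block conditions of the network

  preds-root : ∀ v → isRoot t v ≡ true → length (preds t v) ≡ 0
  preds-root v r with preds t v in e
  ... | [] = refl
  ... | u ∷ _ = ⊥-elim (true≢false r (root-source t (∈preds⇒Arc t (subst (u ∈_) (≡.sym e) (here refl)))))

  -- Two hybrids in `C` are joined by a path avoiding the separating cut vertex: by biconnectivity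
  -- if the cut lies in `C`, by connectivity alone if not. The colour is constant along this path,
  -- yet differs at its ends.
  one-hybrid-per-block : ∀ C → Biconnected network C → ∀ {h h′} →
    C h ≡ true → indeg network h ≡ 2 → C h′ ≡ true → indeg network h′ ≡ 2 → h ≡ h′
  one-hybrid-per-block C (conn , conn⁻) {h} {h′} h∈ hyb h′∈ hyb′
    with hybrids-separated t {vertex h} {vertex h′} (trans (≡.sym (indegree h)) hyb) (trans (≡.sym (indegree h′)) hyb′)
  ... | inj₁ e = vertex-injective e
  ... | inj₂ S = ⊥-elim (apart (side-constant path-off-cut))
    where
    open Separation S
    off : ∀ {i} → vertex i ≢ cut → i ≢ index cut
    off i≢ refl = i≢ (vertex-index cut)
    path-off-cut : UPath network (λ v → C v ≡ true × v ≢ index cut) h h′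
    path-off-cut with C (index cut) in c
    ... | true = conn⁻ (index cut) c h h′ (h∈ , off h≢cut) (h′∈ , off h′≢cut)
    ... | false = weaken (conn h h′ h∈ h′∈)
      where
      avoid : ∀ {i} → C i ≡ true → i ≢ index cut
      avoid i∈ refl = true≢false i∈ c
      weaken : ∀ {i j} → UPath network (λ v → C v ≡ true) i j → UPath network (λ v → C v ≡ true × v ≢ index cut) i j
      weaken (stay i∈) = stay (i∈ , avoid i∈)
      weaken (move i∈ a p) = move (i∈ , avoid i∈) a (weaken p)
    on : ∀ {i} → i ≢ index cut → vertex i ≢ cut
    on i≢ refl = i≢ (≡.sym (index-vertex _))
    start : ∀ {i j} → UPath network (λ v → C v ≡ true × v ≢ index cut) i j → i ≢ index cut
    start (stay (_ , i≢)) = i≢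
    start (move (_ , i≢) _ _) = i≢
    side-constant : ∀ {i j} → UPath network (λ v → C v ≡ true × v ≢ index cut) i j → side (vertex i) ≡ side (vertex j)
    side-constant (stay _) = refl
    side-constant (move (_ , i≢) (inj₁ a) p) =
      trans (closed (arc⇒Arc a) (on i≢) (on (start p))) (side-constant p)
    side-constant (move (_ , i≢) (inj₂ a) p) =
      trans (≡.sym (closed (arc⇒Arc a) (on (start p)) (on i≢))) (side-constant p)

  module _ (leaves-not-root : ∀ {x} (p : x ∈ᵗ t) → isRoot t (position p) ≡ false)
           (root-not-leaf : ¬ IsLeaf t (root t)) where

    degree-zero⇒root : ∀ {v} → length (preds t v) ≡ 0 → isRoot t v ≡ true
    degree-zero⇒root {v} z with leaf-or-inner t v | isRoot t v in r
    ... | _ | true = refl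
    ... | inj₁ (_ , _ , _ , one) | false with () ← trans (≡.sym z) (one r)
    ... | inj₂ (_ , _ , branching) | false with branching r
    ...   | inj₁ (one , _) with () ← trans (≡.sym z) one
    ...   | inj₂ (two , _) with () ← trans (≡.sym z) two

    not-root : ∀ {i} → ¬ IsRoot network i → isRoot t (vertex i) ≡ false
    not-root {i} i≢root with isRoot t (vertex i) in r
    ... | true = ⊥-elim (i≢root (trans (indegree i) (preds-root _ r)))
    ... | false = refl

    -- The two hypotheses of the module hold for every tree except a lone tip, which is the trivial
    -- galled-tree.
    proper : ProperGalledTree network leafIndex
    proper =
      (λ i j a p → acyclic t (arc⇒Arc a) (reach⇒Reaches p)) ,
      leafIndex-injective ,
      (index (root t) , trans (indegree _) (preds-root _ root-is-root) , root-out , root-unique) ,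
      (λ i → InX⇒degrees , degrees⇒InX) ,
      inner-degrees ,
      λ C (bi , _) h h′ h∈ hyb _ h′∈ hyb′ _ → one-hybrid-per-block C bi h∈ hyb h′∈ hyb′
      where
      root-is-root : isRoot t (vertex (index (root t))) ≡ true
      root-is-root = trans (cong (isRoot t) (vertex-index (root t))) (isRoot-root t)
      root-out : 2 ≤ outdeg network (index (root t))
      root-out with leaf-or-inner t (root t)
      ... | inj₁ isLeaf = ⊥-elim (root-not-leaf isLeaf)
      ... | inj₂ (_ , two , _) = subst (2 ≤_)
            (≡.sym (trans (outdegree (index (root t))) (cong (length ∘ succs t) (vertex-index (root t)))))
            (two (isRoot-root t))
      root-unique : ∀ i → IsRoot network i → i ≡ index (root t)
      root-unique i z = trans (≡.sym (index-vertex i))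
        (cong index (isRoot⇒≡root t (degree-zero⇒root (trans (≡.sym (indegree i)) z))))
      InX⇒degrees : ∀ {i} → InX leafIndex i → outdeg network i ≡ 0 × indeg network i ≡ 1
      InX⇒degrees {i} (x , refl) with leaf-or-inner t (vertex i)
      ... | inj₁ (_ , _ , none , one) = trans (outdegree i) none , trans (indegree i)
            (one (trans (cong (isRoot t) (vertex-leafIndex x)) (leaves-not-root (all x))))
      ... | inj₂ (l≢odot , _) = ⊥-elim (l≢odot (label-leafIndex x))
      degrees⇒InX : ∀ {i} → outdeg network i ≡ 0 × indeg network i ≡ 1 → InX leafIndex i
      degrees⇒InX {i} (none , one) with leaf-or-inner t (vertex i) | isRoot t (vertex i) in r
      ... | inj₁ isLeaf | _ = IsLeaf⇒InX isLeaf
      ... | inj₂ _ | true with () ← trans (≡.sym one) (trans (indegree i) (preds-root _ r))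
      ... | inj₂ (_ , _ , branching) | false = ⊥-elim (ℕ.<⇒≢ (some (branching r)) (≡.sym (trans (≡.sym (outdegree i)) none)))
        where
        some : Branching t (vertex i) → 1 ≤ length (succs t (vertex i))
        some (inj₁ (_ , two)) = ℕ.<⇒≤ two
        some (inj₂ (_ , one)) = one
      inner-degrees : ∀ i → ¬ IsRoot network i → ¬ InX leafIndex i →
        (indeg network i ≡ 1 × 2 ≤ outdeg network i) ⊎ (indeg network i ≡ 2 × 1 ≤ outdeg network i)
      inner-degrees i i≢root i∉X with leaf-or-inner t (vertex i)
      ... | inj₁ isLeaf = ⊥-elim (i∉X (IsLeaf⇒InX isLeaf))
      ... | inj₂ (_ , _ , branching) = Sum.map transport transport (branching (not-root i≢root))
        where
        transport : ∀ {p q} → length (preds t (vertex i)) ≡ p × q ≤ length (succs t (vertex i)) →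
          indeg network i ≡ p × q ≤ outdeg network i
        transport (p , q) = trans (indegree i) p , subst (_ ≤_) (≡.sym (outdegree i)) q

gatex : ∀ {n} {G : Graph n} t → Explained G t → (∀ x → x ∈ᵗ t) → GaTEx G
gatex {n} {G} t explained all =
  m G t explained all , network G t explained all , leafIndex G t explained all , labelling G t explained all ,
  galled t explained all , valid-labelling G t explained all , explains G t explained all
  where
  galled : ∀ t explained all → IsGalledTree (network G t explained all) (leafIndex G t explained all)
  galled t@(leaf x) explained all =
    inj₁ (refl , leafIndex-injective G t explained all , (λ { zero → x , refl }) , λ { zero zero → refl })
  galled t@(node F w ts) explained all =
    inj₂ (proper G t explained all (λ { (at s p) → refl }) λ { ((_ , at s p , ()) , _) })

-- Building the tree

-- Read off from the gall, so that `quad-cross` is also the check that the labels of `gall₄`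
-- reproduce the path.
path-adj : Fin 4 → Fin 4 → Bool
path-adj i j = one gall₄ (meet gall₄ i j)

module _ {n} (G : Graph n) where

  TreeOn : List (Fin n) → Set
  TreeOn xs = ∃ λ t → Explained G t × (∀ {x} → x ∈ᵗ t → x ∈ xs) × (∀ {x} → x ∈ xs → x ∈ᵗ t)

  distinct-sym : ∀ {x y e} → x ≢ y × adj G x y ≡ e → y ≢ x × adj G y x ≡ e
  distinct-sym (x≢y , xy) = ≢-sym x≢y , adj-sym G xy

  quad : Fin n → Fin n → Fin n → Fin n → Fin 4 → Fin n
  quad a b c d 0F = a
  quad a b c d 1F = b
  quad a b c d 2F = c
  quad a b c d 3F = d

  quad-cross : ∀ {a b c d} → IsInducedP4 G a b c d → ∀ i j → i ≢ j →
    quad a b c d i ≢ quad a b c d j × adj G (quad a b c d i) (quad a b c d j) ≡ path-adj i j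
  quad-cross _ 0F 0F i≢i = ⊥-elim (i≢i refl)
  quad-cross ((a≢b , _) , (ab , _) , _) 0F 1F _ = a≢b , ab
  quad-cross ((_ , a≢c , _) , _ , (ac , _)) 0F 2F _ = a≢c , ac
  quad-cross ((_ , _ , a≢d , _) , _ , (_ , _ , ad)) 0F 3F _ = a≢d , ad
  quad-cross _ 1F 1F i≢i = ⊥-elim (i≢i refl)
  quad-cross ((_ , _ , _ , b≢c , _) , (_ , bc , _) , _) 1F 2F _ = b≢c , bc
  quad-cross ((_ , _ , _ , _ , b≢d , _) , _ , (_ , bd , _)) 1F 3F _ = b≢d , bd
  quad-cross _ 2F 2F i≢i = ⊥-elim (i≢i refl)
  quad-cross ((_ , _ , _ , _ , _ , c≢d) , (_ , _ , cd) , _) 2F 3F _ = c≢d , cd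
  quad-cross _ 3F 3F i≢i = ⊥-elim (i≢i refl)
  quad-cross P 1F 0F _ = distinct-sym (quad-cross P 0F 1F λ ())
  quad-cross P 2F 0F _ = distinct-sym (quad-cross P 0F 2F λ ())
  quad-cross P 3F 0F _ = distinct-sym (quad-cross P 0F 3F λ ())
  quad-cross P 2F 1F _ = distinct-sym (quad-cross P 1F 2F λ ())
  quad-cross P 3F 1F _ = distinct-sym (quad-cross P 1F 3F λ ())
  quad-cross P 3F 2F _ = distinct-sym (quad-cross P 2F 3F λ ())

  module _ {a b c d : Fin n} where

    quad-∈ : ∀ {rs} i → quad a b c d i ∈ a ∷ b ∷ c ∷ d ∷ rs
    quad-∈ 0F = here refl
    quad-∈ 1F = there (here refl)
    quad-∈ 2F = there (there (here refl))
    quad-∈ 3F = there (there (there (here refl)))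

    ∈-quad : ∀ {x rs} → x ∈ a ∷ b ∷ c ∷ d ∷ rs → (∃ λ i → quad a b c d i ≡ x) ⊎ x ∈ rs
    ∈-quad (here refl) = inj₁ (0F , refl)
    ∈-quad (there (here refl)) = inj₁ (1F , refl)
    ∈-quad (there (there (here refl))) = inj₁ (2F , refl)
    ∈-quad (there (there (there (here refl)))) = inj₁ (3F , refl)
    ∈-quad (there (there (there (there x∈)))) = inj₂ x∈

  treeOn-single : ∀ x → TreeOn [ x ]
  treeOn-single x = leaf x , leaf , (λ { here → here refl }) , λ { (here refl) → here }

  treeOn-split : ∀ {xs} e as bs → xs ↭ as ++ bs → (∀ {x y} → x ∈ as → y ∈ bs → x ≢ y × adj G x y ≡ e) →
    TreeOn as → TreeOn bs → TreeOn xs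
  treeOn-split {xs} e as bs perm cross (t , et , t⇒ , ⇒t) (u , eu , u⇒ , ⇒u) =
    node (cherry e) (cherry-valid e) ts , node explained cross′ , members , covers
    where
    ts : Fin 2 → Tree (Fin n)
    ts 0F = t
    ts 1F = u
    explained : ∀ s → Explained G (ts s)
    explained 0F = et
    explained 1F = eu
    cross′ : ∀ {s s′ x y} → s ≢ s′ → x ∈ᵗ ts s → y ∈ᵗ ts s′ → x ≢ y × adj G x y ≡ e
    cross′ {0F} {0F} s≢s _ _ = ⊥-elim (s≢s refl)
    cross′ {0F} {1F} _ p q = cross (t⇒ p) (u⇒ q)
    cross′ {1F} {0F} _ p q = distinct-sym (cross (t⇒ q) (u⇒ p))
    cross′ {1F} {1F} s≢s _ _ = ⊥-elim (s≢s refl)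
    members : ∀ {x} → x ∈ᵗ node (cherry e) (cherry-valid e) ts → x ∈ xs
    members (at 0F p) = ∈-resp-↭ (↭-sym perm) (∈-++⁺ˡ (t⇒ p))
    members (at 1F p) = ∈-resp-↭ (↭-sym perm) (∈-++⁺ʳ as (u⇒ p))
    covers : ∀ {x} → x ∈ xs → x ∈ᵗ node (cherry e) (cherry-valid e) ts
    covers x∈ with ∈-++⁻ as (∈-resp-↭ perm x∈)
    ... | inj₁ p = at 0F (⇒t p)
    ... | inj₂ p = at 1F (⇒u p)

  treeOn-path : ∀ {xs a b c d} → xs ↭ a ∷ b ∷ c ∷ d ∷ [] → IsInducedP4 G a b c d → TreeOn xs
  treeOn-path {xs} {a} {b} {c} {d} perm P =
    node gall₄ gall₄-valid (leaf ∘ quad a b c d) , node (λ _ → leaf) cross ,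
    (λ { (at s here) → ∈-resp-↭ (↭-sym perm) (quad-∈ s) }) , covers
    where
    cross : ∀ {s s′ x y} → s ≢ s′ → x ∈ᵗ leaf (quad a b c d s) → y ∈ᵗ leaf (quad a b c d s′) →
      x ≢ y × adj G x y ≡ path-adj s s′
    cross s≢s′ here here = quad-cross P _ _ s≢s′
    covers : ∀ {x} → x ∈ xs → x ∈ᵗ node gall₄ gall₄-valid (leaf ∘ quad a b c d)
    covers x∈ with inj₁ (i , refl) ← ∈-quad (∈-resp-↭ perm x∈) = at i here

  treeOn-path-mid : ∀ {xs a b c d rs} → xs ↭ a ∷ b ∷ c ∷ d ∷ rs → IsInducedP4 G a b c d →
    (∀ {r} → r ∈ rs → Sees G false true r a b c d) → TreeOn rs → TreeOn xs
  treeOn-path-mid {xs} {a} {b} {c} {d} {rs} perm P mid (t , et , t⇒ , ⇒t) =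
    node gall₅ gall₅-valid ts , node explained cross , members , covers
    where
    ts : Fin 5 → Tree (Fin n)
    ts zero = t
    ts (suc i) = leaf (quad a b c d i)
    explained : ∀ s → Explained G (ts s)
    explained zero = et
    explained (suc i) = leaf
    cross-mid : ∀ {r} → r ∈ rs → ∀ i →
      r ≢ quad a b c d i × adj G r (quad a b c d i) ≡ one gall₅ (meet gall₅ zero (suc i))
    cross-mid r∈ i with mid r∈ | mid⇒∉ G P (mid r∈)
    cross-mid r∈ 0F | ra , _ | r≢a , _ = r≢a , ra
    cross-mid r∈ 1F | _ , rb , _ | _ , r≢b , _ = r≢b , rb
    cross-mid r∈ 2F | _ , _ , rc , _ | _ , _ , r≢c , _ = r≢c , rc
    cross-mid r∈ 3F | _ , _ , _ , rd | _ , _ , _ , r≢d = r≢d , rd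
    -- `path-meet` uses only the vertices 0 to 3, which both galls share; passing to `gall₅` moves
    -- the hybrid vertex from 4 to 5.
    labels-agree : ∀ (u : Fin 4) → one gall₄ (inject₁ u) ≡ one gall₅ (inject₁ (inject₁ u))
    labels-agree 0F = refl
    labels-agree 1F = refl
    labels-agree 2F = refl
    labels-agree 3F = refl
    cross : ∀ {s s′ x y} → s ≢ s′ → x ∈ᵗ ts s → y ∈ᵗ ts s′ →
      x ≢ y × adj G x y ≡ one gall₅ (meet gall₅ s s′)
    cross {zero} {zero} s≢s _ _ = ⊥-elim (s≢s refl)
    cross {zero} {suc j} _ p here = cross-mid (t⇒ p) j
    cross {suc i} {zero} _ here q = distinct-sym (cross-mid (t⇒ q) i)
    cross {suc i} {suc j} s≢s′ here here with x≢y , xy ← quad-cross P i j (s≢s′ ∘ cong suc) =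
      x≢y , trans xy (labels-agree (path-meet i j))
    members : ∀ {x} → x ∈ᵗ node gall₅ gall₅-valid ts → x ∈ xs
    members (at zero p) = ∈-resp-↭ (↭-sym perm) (∈-++⁺ʳ (a ∷ b ∷ c ∷ d ∷ []) (t⇒ p))
    members (at (suc i) here) = ∈-resp-↭ (↭-sym perm) (quad-∈ i)
    covers : ∀ {x} → x ∈ xs → x ∈ᵗ node gall₅ gall₅-valid ts
    covers x∈ with ∈-quad (∈-resp-↭ perm x∈)
    ... | inj₁ (i , refl) = at (suc i) here
    ... | inj₂ r∈ = at zero (⇒t r∈)

  -- The parts of a decomposition are known only up to permutation and are not sublists of the
  -- input, so the recursion runs on a bound `k` for the length.
  treeOn : P4Reducible G → ∀ k x xs → length xs < k → Unique (x ∷ xs) → TreeOn (x ∷ xs)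
  treeOn red (suc k) x xs (s≤s len) u with decompose G red x xs u
  ... | single x refl = treeOn-single x
  ... | path a b c d [] perm P mid = treeOn-path perm P
  ... | path a b c d (r ∷ rs) perm P mid = treeOn-path-mid perm P mid
        -- Taking away `a` leaves `b`, `c`, `d` besides `r ∷ rs`, which accounts for the 3.
        (treeOn red k r rs (ℕ.≤-trans (ℕ.m≤n+m (suc (length rs)) 3) (shorter perm))
          (Unique.drop⁺ 4 (Unique-resp-↭ perm u)))
    where
    shorter : ∀ {y ys} → x ∷ xs ↭ y ∷ ys → length ys ≤ k
    shorter perm = subst (_≤ k) (ℕ.suc-injective (↭-length perm)) len
  ... | split e a as b bs perm cross = treeOn-split e (a ∷ as) (b ∷ bs) perm cross
        (treeOn red k a as (ℕ.≤-trans (ℕ.≤-trans (s≤s (ℕ.m≤m+n _ _)) (ℕ.≤-reflexive (≡.sym (ℕ.+-suc _ _)))) both)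
          (proj₁ unique))
        (treeOn red k b bs (ℕ.≤-trans (ℕ.m≤n+m _ (length as)) both) (proj₂ unique))
    where
    unique : Unique (a ∷ as) × Unique (b ∷ bs)
    unique = Unique-++⁻ (a ∷ as) (Unique-resp-↭ perm u)
    both : length as + suc (length bs) ≤ k
    both = subst (_≤ k) (trans (ℕ.suc-injective (↭-length perm)) (length-++ as)) len

mainTheorem16 : (n : ℕ) → (G : Graph (suc n)) → P4Reducible G → GaTEx G
mainTheorem16 n G red
  with t , explained , _ , covers ← treeOn G red (suc n) zero (List.tabulate suc)
         (ℕ.≤-reflexive (cong suc (length-tabulate suc))) (Unique.allFin⁺ (suc n))
  = gatex t explained (λ x → covers (∈-allFin x))
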